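{- Let $n\ge1$. Let $\langle\vec{2}_{2n\times 2n}\rangle$ be the cyclic subgroup of the sandpile group $\mathcal{S}(\mathrm{S}\Gamma_{2n\times 2n})$ generated by the all-$2$s element $\vec 2_{2n\times2n}$ (two grains of sand on each non-sink vertex) of the sandpile grid graph $\mathrm{S}\Gamma_{2n\times 2n}$, and let $\vec{2}_{n}$ denote the all-$2$s element on the sandpile graph $P_n$. Then the mapping $\psi\colon\langle\vec{2}_{2n\times 2n}\rangle\to\mathcal{S}(P_n)$ determined by $\psi(\vec{2}_{2n\times 2n})=\vec{2}_n$ is a well-defined injective homomorphism of groups.
   Context: For a finite connected undirected multigraph (edge weights = edge multiplicities $\mathrm{wt}(u,v)=\mathrm{wt}(v,u)\in\mathbb{N}$) with a distinguished sink vertex $s$ and non-sink vertex set $\widetilde V$, the reduced Laplacian is the $\mathbb{Z}$-linear map $\widetilde\Delta\colon\mathbb{Z}\widetilde V\to\mathbb{Z}\widetilde V$, $\widetilde\Delta(v)=\deg(v)\,v-\sum_{w\in\widetilde V}\mathrm{wt}(v,w)\,w$, where $\deg(v)$ counts all edges at $v$ including those to $s$. The sandpile group $\mathcal{S}$ is identified with $\mathbb{Z}\widetilde V/\mathrm{image}(\widetilde\Delta)$, and an element of $\mathbb{Z}\widetilde V$ is regarded as an element of the sandpile group via its class. The sandpile grid graph $\mathrm{S}\Gamma_{p\times q}$ has non-sink vertices $[p]\times[q]$, an edge of weight $1$ between $(a,b)$ and $(a',b')$ whenever $|a-a'|+|b-b'|=1$, and edges from grid vertices to the sink $s$ with weights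 chosen so that every non-sink vertex has total degree $4$. The sandpile graph $P_n$ has vertices $\{v_{i,j}:1\leq i\leq n,\ 1\leq j \leq i\}\cup\{s\}$ with sink $s$. Vertices $v_{i,j}$ and $v_{i',j'}$ are joined by an edge of weight $1$ when $|i-i'|+|j-j'|=1$, and every vertex of the form $v_{n,j}$ ($1\le j\le n$) is joined to $s$ by an edge of weight $1$; there are no other edges. -}

module Defs where

open import Algebra.Bundles using (AbelianGroup)
import Algebra.Definitions.RawMonoid as RawMonoidDefs
import Algebra.Properties.AbelianGroup as AbelianGroupProperties
import Algebra.Properties.CommutativeSemigroup as CommutativeSemigroupProperties
import Algebra.Properties.Monoid.Mult as Mult
open import Data.Bool.Base using (true; false; if_then_else_; T)
open import Data.Fin.Base as Fin using (Fin; toℕ; fromℕ<)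
import Data.Fin.Properties as Fin
open import Data.Integer.Base as ℤ using (ℤ; +_; -[1+_]; _⊖_)
import Data.Integer.Properties as ℤ
open import Data.Integer.Tactic.RingSolver using (solve-∀)
open import Data.List.Base
  using (List; []; _∷_; map; foldr; length; allFin; cartesianProduct; concat)
open import Data.List.Membership.Propositional using (_∈_)
open import Data.List.Membership.Propositional.Properties
  using (∈-allFin; ∈-cartesianProduct⁺; ∈-map⁺; ∈-map⁻; ∈-concat⁺′)
open import Data.List.Relation.Binary.Disjoint.Propositional using (Disjoint)
open import Data.List.Relation.Unary.All as All using (All; []; _∷_)
import Data.List.Relation.Unary.All.Properties as All
open import Data.List.Relation.Unary.AllPairs as AllPairs using ([]; _∷_)
import Data.List.Relation.Unary.AllPairs.Properties as AllPairs
open import Data.List.Relation.Unary.Any using (here; there)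
open import Data.List.Relation.Unary.Unique.Propositional using (Unique)
import Data.List.Relation.Unary.Unique.Propositional.Properties as Unique
open import Data.Maybe.Base using (Maybe; just; nothing)
open import Data.Nat.Base as ℕ
  using (ℕ; zero; suc; pred; _≡ᵇ_; ∣_-_∣; _∸_; _≤_; _<_; z≤n; s≤s)
open import Data.Nat.ListAction using (sum)
import Data.Nat.Properties as ℕ
open import Data.Product.Base using (Σ; ∃; _×_; _,_; proj₁; proj₂)
open import Data.Product.Properties using (≡-dec)
open import Data.Sum.Base using (_⊎_; inj₁; inj₂)
open import Function.Base using (_∘_)
open import Level using (0ℓ; _⊔_)
open import Relation.Binary.Construct.Closure.ReflexiveTransitive as Star
  using (Star; _◅_; _◅◅_)
open import Relation.Binary.Definitions using (DecidableEquality)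
open import Relation.Binary.PropositionalEquality
  using (_≡_; _≢_; refl; sym; trans; cong; cong₂; subst)
import Relation.Binary.Reasoning.Setoid as SetoidReasoning
open import Relation.Nullary using (yes; no; does; contradiction)

∑ : {A : Set} → List A → (A → ℤ) → ℤ
∑ xs f = foldr (λ x s → f x ℤ.+ s) (+ 0) xs

-- The full vertex set is Maybe Ṽ, the sink being nothing.

record SandpileGraph : Set₁ where
  field
    Ṽ         : Set
    vertices  : List Ṽ
    complete  : ∀ v → v ∈ vertices
    unique    : Unique vertices
    wt        : Maybe Ṽ → Maybe Ṽ → ℕ
    wt-sym    : ∀ u v → wt u v ≡ wt v u
    connected : ∀ u v → Star (λ x y → 0 < wt x y) u v

  deg : Ṽ → ℕ
  deg v = sum (map (λ w → wt (just v) (just w)) vertices)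
          ℕ.+ wt (just v) nothing

  ℤṼ : Set
  ℤṼ = Ṽ → ℤ

  -- The linear extension of  v ↦ deg(v) v - ∑_w wt(v,w) w,  written as
  -- the coefficient of Δ̃(∑_v c(v) v) at w.

  Δ̃ : ℤṼ → ℤṼ
  Δ̃ c w = + deg w ℤ.* c w
          ℤ.- ∑ vertices (λ v → c v ℤ.* + wt (just v) (just w))

  infix 4 _∼_

  record _∼_ (x y : ℤṼ) : Set where
    constructor image
    field
      preimage : ℤṼ
      equality : ∀ v → x v ℤ.- y v ≡ Δ̃ preimage v

∑-+ : {A : Set} (xs : List A) (f g k : A → ℤ) →
      (∀ x → k x ≡ f x ℤ.+ g x) → ∑ xs k ≡ ∑ xs f ℤ.+ ∑ xs g
∑-+ []       f g k _ = refl
∑-+ (x ∷ xs) f g k e = trans (cong₂ ℤ._+_ (e x) (∑-+ xs f g k e))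
  (lem (f x) (g x) (∑ xs f) (∑ xs g))
  where
  lem : ∀ a b c d → (a ℤ.+ b) ℤ.+ (c ℤ.+ d) ≡ (a ℤ.+ c) ℤ.+ (b ℤ.+ d)
  lem = solve-∀

∑-neg : {A : Set} (xs : List A) (f k : A → ℤ) →
        (∀ x → k x ≡ ℤ.- f x) → ∑ xs k ≡ ℤ.- ∑ xs f
∑-neg []       f k _ = refl
∑-neg (x ∷ xs) f k e = trans (cong₂ ℤ._+_ (e x) (∑-neg xs f k e))
  (sym (ℤ.neg-distrib-+ (f x) (∑ xs f)))

module _ (G : SandpileGraph) where
  open SandpileGraph G

  Δ̃-+ : ∀ h k v → Δ̃ (λ u → h u ℤ.+ k u) v ≡ Δ̃ h v ℤ.+ Δ̃ k v
  Δ̃-+ h k v = trans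
    (cong (λ s → + deg v ℤ.* (h v ℤ.+ k v) ℤ.- s)
      (∑-+ vertices (λ u → h u ℤ.* wtv u) (λ u → k u ℤ.* wtv u) _
        (λ u → ℤ.*-distribʳ-+ (wtv u) (h u) (k u))))
    (lem (+ deg v) (h v) (k v) _ _)
    where
    wtv : Ṽ → ℤ
    wtv u = + wt (just u) (just v)
    lem : ∀ d a b s t → d ℤ.* (a ℤ.+ b) ℤ.- (s ℤ.+ t)
                      ≡ (d ℤ.* a ℤ.- s) ℤ.+ (d ℤ.* b ℤ.- t)
    lem = solve-∀

  Δ̃-neg : ∀ h v → Δ̃ (λ u → ℤ.- h u) v ≡ ℤ.- Δ̃ h v
  Δ̃-neg h v = trans
    (cong (λ s → + deg v ℤ.* (ℤ.- h v) ℤ.- s)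
      (∑-neg vertices _ _ (λ u → sym (ℤ.neg-distribˡ-* (h u) (+ wt (just u) (just v))))))
    (lem (+ deg v) (h v) _)
    where
    lem : ∀ d a s → d ℤ.* (ℤ.- a) ℤ.- (ℤ.- s) ≡ ℤ.- (d ℤ.* a ℤ.- s)
    lem = solve-∀

  Δ̃-0 : ∀ v → Δ̃ (λ _ → + 0) v ≡ + 0
  Δ̃-0 v = trans
    (cong (λ s → + deg v ℤ.* + 0 ℤ.- s) (∑-0 vertices))
    (cong (ℤ._- + 0) (ℤ.*-zeroʳ (+ deg v)))
    where
    ∑-0 : ∀ xs → ∑ xs (λ u → + 0 ℤ.* + wt (just u) (just v)) ≡ + 0
    ∑-0 []       = refl
    ∑-0 (x ∷ xs) = trans (ℤ.+-identityˡ _) (∑-0 xs)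

  ≗⇒∼ : {x y : ℤṼ} → (∀ v → x v ≡ y v) → x ∼ y
  ≗⇒∼ e = image (λ _ → + 0) λ v → trans (ℤ.i≡j⇒i-j≡0 (e v)) (sym (Δ̃-0 v))

  ∼-sym : {x y : ℤṼ} → x ∼ y → y ∼ x
  ∼-sym {x} {y} (image h e) = image (λ v → ℤ.- h v) λ v →
    trans (lem (x v) (y v)) (trans (cong ℤ.-_ (e v)) (sym (Δ̃-neg h v)))
    where
    lem : ∀ a b → b ℤ.- a ≡ ℤ.- (a ℤ.- b)
    lem = solve-∀

  ∼-trans : {x y z : ℤṼ} → x ∼ y → y ∼ z → x ∼ z
  ∼-trans {x} {y} {z} (image h e) (image k f) = image (λ v → h v ℤ.+ k v) λ v →
    trans (lem (x v) (y v) (z v))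
          (trans (cong₂ ℤ._+_ (e v) (f v)) (sym (Δ̃-+ h k v)))
    where
    lem : ∀ a b c → a ℤ.- c ≡ (a ℤ.- b) ℤ.+ (b ℤ.- c)
    lem = solve-∀

  +-resp-∼ : {x y u w : ℤṼ} → x ∼ y → u ∼ w →
             (λ v → x v ℤ.+ u v) ∼ (λ v → y v ℤ.+ w v)
  +-resp-∼ {x} {y} {u} {w} (image h e) (image k f) = image (λ v → h v ℤ.+ k v) λ v →
    trans (lem (x v) (y v) (u v) (w v))
          (trans (cong₂ ℤ._+_ (e v) (f v)) (sym (Δ̃-+ h k v)))
    where
    lem : ∀ a b c d → (a ℤ.+ c) ℤ.- (b ℤ.+ d) ≡ (a ℤ.- b) ℤ.+ (c ℤ.- d)
    lem = solve-∀

  neg-resp-∼ : {x y : ℤṼ} → x ∼ y → (λ v → ℤ.- x v) ∼ (λ v → ℤ.- y v)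
  neg-resp-∼ {x} {y} (image h e) = image (λ v → ℤ.- h v) λ v →
    trans (lem (x v) (y v)) (trans (cong ℤ.-_ (e v)) (sym (Δ̃-neg h v)))
    where
    lem : ∀ a b → (ℤ.- a) ℤ.- (ℤ.- b) ≡ ℤ.- (a ℤ.- b)
    lem = solve-∀

  𝒮 : AbelianGroup 0ℓ 0ℓ
  𝒮 = record
    { Carrier = ℤṼ
    ; _≈_     = _∼_
    ; _∙_     = λ x y v → x v ℤ.+ y v
    ; ε       = λ _ → + 0
    ; _⁻¹     = λ x v → ℤ.- x v
    ; isAbelianGroup = record
      { isGroup = record
        { isMonoid = record
          { isSemigroup = record
            { isMagma = record
              { isEquivalence = record
                { refl  = ≗⇒∼ (λ _ → refl)
                ; sym   = ∼-sym
                ; trans = ∼-trans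
                }
              ; ∙-cong = +-resp-∼
              }
            ; assoc = λ x y z → ≗⇒∼ (λ v → ℤ.+-assoc (x v) (y v) (z v))
            }
          ; identity = (λ x → ≗⇒∼ (λ v → ℤ.+-identityˡ (x v)))
                     , (λ x → ≗⇒∼ (λ v → ℤ.+-identityʳ (x v)))
          }
        ; inverse = (λ x → ≗⇒∼ (λ v → ℤ.+-inverseˡ (x v)))
                  , (λ x → ≗⇒∼ (λ v → ℤ.+-inverseʳ (x v)))
        ; ⁻¹-cong = neg-resp-∼
        }
      ; comm = λ x y → ≗⇒∼ (λ v → ℤ.+-comm (x v) (y v))
      }
    }

  2⃗ : AbelianGroup.Carrier 𝒮
  2⃗ = λ _ → + 2

module Cyclic {a ℓ} (A : AbelianGroup a ℓ) where
  open AbelianGroup A renaming (refl to ≈-refl; sym to ≈-sym; trans to ≈-trans)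
  open RawMonoidDefs rawMonoid using () renaming (_×_ to _×ₙ_)
  open Mult monoid using (×-homo-+)
  open AbelianGroupProperties A
    using (⁻¹-involutive; ⁻¹-∙-comm; ⁻¹-anti-homo‿-; ε⁻¹≈ε)
  open SetoidReasoning setoid

  infixr 8 _·_

  _·_ : ℤ → Carrier → Carrier
  (+ n)    · g = n ×ₙ g
  -[1+ n ] · g = (suc n ×ₙ g) ⁻¹

  ·-⊖ : ∀ m n g → (m ⊖ n) · g ≈ (m ×ₙ g) ∙ (n ×ₙ g) ⁻¹
  ·-⊖ zero    zero    g = ≈-sym (inverseʳ ε)
  ·-⊖ zero    (suc n) g = ≈-sym (identityˡ _)
  ·-⊖ (suc m) zero    g = ≈-sym (≈-trans (∙-congˡ ε⁻¹≈ε) (identityʳ _))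
  ·-⊖ (suc m) (suc n) g rewrite ℤ.[1+m]⊖[1+n]≡m⊖n m n = begin
    (m ⊖ n) · g                                   ≈⟨ ·-⊖ m n g ⟩
    (m ×ₙ g) ∙ (n ×ₙ g) ⁻¹                        ≈⟨ ∙-congʳ (identityʳ _) ⟨
    ((m ×ₙ g) ∙ ε) ∙ (n ×ₙ g) ⁻¹                  ≈⟨ ∙-congʳ (∙-congˡ (inverseʳ g)) ⟨
    ((m ×ₙ g) ∙ (g ∙ g ⁻¹)) ∙ (n ×ₙ g) ⁻¹         ≈⟨ ∙-congʳ (assoc _ _ _) ⟨
    (((m ×ₙ g) ∙ g) ∙ g ⁻¹) ∙ (n ×ₙ g) ⁻¹         ≈⟨ assoc _ _ _ ⟩
    ((m ×ₙ g) ∙ g) ∙ (g ⁻¹ ∙ (n ×ₙ g) ⁻¹)         ≈⟨ ∙-cong (comm _ _) (⁻¹-∙-comm _ _) ⟩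
    (g ∙ (m ×ₙ g)) ∙ (g ∙ (n ×ₙ g)) ⁻¹            ∎

  ·-+ : ∀ k l g → (k ℤ.+ l) · g ≈ (k · g) ∙ (l · g)
  ·-+ (+ m)    (+ n)    g = ×-homo-+ g m n
  ·-+ (+ m)    -[1+ n ] g = ·-⊖ m (suc n) g
  ·-+ -[1+ m ] (+ n)    g = ≈-trans (·-⊖ n (suc m) g) (comm _ _)
  ·-+ -[1+ m ] -[1+ n ] g = ≈-trans
    (⁻¹-cong (≈-trans (∙-congˡ (∙-congˡ (×-homo-+ g m n)))
      (begin
        g ∙ (g ∙ ((m ×ₙ g) ∙ (n ×ₙ g)))  ≈⟨ ∙-congˡ (assoc _ _ _) ⟨
        g ∙ ((g ∙ (m ×ₙ g)) ∙ (n ×ₙ g))  ≈⟨ ∙-congˡ (∙-congʳ (comm _ _)) ⟩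
        g ∙ (((m ×ₙ g) ∙ g) ∙ (n ×ₙ g))  ≈⟨ ∙-congˡ (assoc _ _ _) ⟩
        g ∙ ((m ×ₙ g) ∙ (g ∙ (n ×ₙ g)))  ≈⟨ assoc _ _ _ ⟨
        (suc m ×ₙ g) ∙ (suc n ×ₙ g)      ∎)))
    (≈-sym (⁻¹-∙-comm _ _))

  ·-neg : ∀ k g → (ℤ.- k) · g ≈ (k · g) ⁻¹
  ·-neg (+ zero)    g = ≈-sym ε⁻¹≈ε
  ·-neg (+ (suc n)) g = ≈-refl
  ·-neg -[1+ n ]    g = ≈-sym (⁻¹-involutive _)

  ⟨_⟩ : Carrier → AbelianGroup (a ⊔ ℓ) ℓ
  ⟨ g ⟩ = record
    { Carrier = Σ Carrier λ x → ∃ λ k → x ≈ k · g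
    ; _≈_     = λ x y → proj₁ x ≈ proj₁ y
    ; _∙_     = λ { (x , k , p) (y , l , q) →
                    x ∙ y , k ℤ.+ l , ≈-trans (∙-cong p q) (≈-sym (·-+ k l g)) }
    ; ε       = ε , + 0 , ≈-refl
    ; _⁻¹     = λ { (x , k , p) →
                    x ⁻¹ , ℤ.- k , ≈-trans (⁻¹-cong p) (≈-sym (·-neg k g)) }
    ; isAbelianGroup = record
      { isGroup = record
        { isMonoid = record
          { isSemigroup = record
            { isMagma = record
              { isEquivalence = record
                { refl = ≈-refl ; sym = ≈-sym ; trans = ≈-trans }
              ; ∙-cong = ∙-cong
              }
            ; assoc = λ x y z → assoc (proj₁ x) (proj₁ y) (proj₁ z)
            }
          ; identity = (λ x → identityˡ (proj₁ x)) , (λ x → identityʳ (proj₁ x))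
          }
        ; inverse = (λ x → inverseˡ (proj₁ x)) , (λ x → inverseʳ (proj₁ x))
        ; ⁻¹-cong = ⁻¹-cong
        }
      ; comm = λ x y → comm (proj₁ x) (proj₁ y)
      }
    }

  generator : (g : Carrier) → AbelianGroup.Carrier ⟨ g ⟩
  generator g = g , + 1 , ≈-sym (identityʳ g)

open Cyclic public using (⟨_⟩; generator)

adj : ℕ × ℕ → ℕ × ℕ → ℕ
adj (a , b) (a′ , b′) = if ∣ a - a′ ∣ ℕ.+ ∣ b - b′ ∣ ≡ᵇ 1 then 1 else 0

adj-sym : ∀ x y → adj x y ≡ adj y x
adj-sym (a , b) (a′ , b′)
  rewrite ℕ.∣-∣-comm a a′ | ℕ.∣-∣-comm b b′ = refl

∣-∣≡1 : ∀ m n → ∣ m - n ∣ ≡ 1 → n ≡ suc m ⊎ suc n ≡ m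
∣-∣≡1 zero    n       e = inj₁ e
∣-∣≡1 (suc m) zero    e = inj₂ (sym e)
∣-∣≡1 (suc m) (suc n) e with ∣-∣≡1 m n e
... | inj₁ p = inj₁ (cong suc p)
... | inj₂ p = inj₂ (cong suc p)

adj-step : ∀ a b → adj (suc a , b) (a , b) ≡ 1
adj-step zero    zero    = refl
adj-step zero    (suc b) = adj-step zero b
adj-step (suc a) b       = adj-step a b

T⇒ : ∀ b {m} → (if b then 1 else 0) ≡ suc m → T b
T⇒ true _ = _

+≡1 : ∀ m n → m ℕ.+ n ≡ 1 → (m ≡ 1 × n ≡ 0) ⊎ (m ≡ 0 × n ≡ 1)
+≡1 zero          n    e = inj₂ (refl , e)
+≡1 (suc zero)    zero _ = inj₁ (refl , refl)

_≟²_ : DecidableEquality (ℕ × ℕ)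
_≟²_ = ≡-dec ℕ._≟_ ℕ._≟_

δ : ℕ × ℕ → ℕ × ℕ → ℕ
δ x y = if does (x ≟² y) then 1 else 0

count : List (ℕ × ℕ) → ℕ × ℕ → ℕ
count xs y = sum (map (λ x → δ x y) xs)

δ-refl : ∀ x → δ x x ≡ 1
δ-refl x with x ≟² x
... | yes _ = refl
... | no x≢x = contradiction refl x≢x

δ-≢ : ∀ {x y} → x ≢ y → δ x y ≡ 0
δ-≢ {x} {y} x≢y with x ≟² y
... | yes p = contradiction p x≢y
... | no _  = refl

∈⇒count : ∀ {xs y} → y ∈ xs → 1 ≤ count xs y
∈⇒count {y = y} (here refl) = 
  ℕ.≤-trans (ℕ.≤-reflexive (sym (δ-refl y))) (ℕ.m≤m+n _ _)
∈⇒count (there p) = ℕ.≤-trans (∈⇒count p) (ℕ.m≤n+m _ _)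

module _ {A : Set} (g : A → ℕ × ℕ) (g-inj : ∀ {x y} → g x ≡ g y → x ≡ y) where

  ∑δ≡0 : ∀ x {ws} → All (λ w → x ≢ g w) ws → sum (map (λ w → δ x (g w)) ws) ≡ 0
  ∑δ≡0 x []       = refl
  ∑δ≡0 x (p ∷ ps) = cong₂ ℕ._+_ (δ-≢ p) (∑δ≡0 x ps)

  ∑δ≤1 : ∀ x {ws} → Unique ws → sum (map (λ w → δ x (g w)) ws) ≤ 1
  ∑δ≤1 x []                    = z≤n
  ∑δ≤1 x {w ∷ ws} (w∉ws ∷ u) with x ≟² g w
  ... | yes refl = s≤s (ℕ.≤-reflexive (∑δ≡0 x (All.map (λ p q → p (g-inj q)) w∉ws)))
  ... | no _     = ∑δ≤1 x u

  sum-map-+ : ∀ (f h : A → ℕ) ws →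
    sum (map (λ w → f w ℕ.+ h w) ws) ≡ sum (map f ws) ℕ.+ sum (map h ws)
  sum-map-+ f h []       = refl
  sum-map-+ f h (w ∷ ws) =
    trans (cong ((f w ℕ.+ h w) ℕ.+_) (sum-map-+ f h ws))
          (interchange (f w) (h w) (sum (map f ws)) (sum (map h ws)))
    where
    open CommutativeSemigroupProperties ℕ.+-commutativeSemigroup using (interchange)

  ∑count≤length : ∀ xs {ws} → Unique ws → sum (map (count xs ∘ g) ws) ≤ length xs
  ∑count≤length [] {ws} _ = ℕ.≤-reflexive (∑0 ws)
    where
    ∑0 : ∀ (ws : List A) → sum (map (λ _ → 0) ws) ≡ 0
    ∑0 []       = refl
    ∑0 (_ ∷ ws) = ∑0 ws
  ∑count≤length (x ∷ xs) {ws} u = ℕ.≤-trans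
    (ℕ.≤-reflexive (sum-map-+ (δ x ∘ g) (count xs ∘ g) ws))
    (ℕ.+-mono-≤ (∑δ≤1 x u) (∑count≤length xs u))

  sum-mono : ∀ {f h : A → ℕ} → (∀ w → f w ≤ h w) → ∀ ws → sum (map f ws) ≤ sum (map h ws)
  sum-mono p []       = z≤n
  sum-mono p (w ∷ ws) = ℕ.+-mono-≤ (p w) (sum-mono p ws)

  ∑adj≤length : ∀ v xs → (∀ y → adj v y ≡ 1 → y ∈ xs) →
                ∀ {ws} → Unique ws → sum (map (λ w → adj v (g w)) ws) ≤ length xs
  ∑adj≤length v xs p {ws} u =
    ℕ.≤-trans (sum-mono (λ w → bound (g w)) ws) (∑count≤length xs u)
    where
    dich : ∀ b → (if b then 1 else 0) ≡ 0 ⊎ (if b then 1 else 0) ≡ 1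
    dich true  = inj₂ refl
    dich false = inj₁ refl
    bound : ∀ y → adj v y ≤ count xs y
    bound y with dich (∣ proj₁ v - proj₁ y ∣ ℕ.+ ∣ proj₂ v - proj₂ y ∣ ≡ᵇ 1)
    ... | inj₁ e = ℕ.≤-trans (ℕ.≤-reflexive e) z≤n
    ... | inj₂ e = ℕ.≤-trans (ℕ.≤-reflexive e) (∈⇒count (p y e))

adj≡1 : ∀ a b a′ b′ → adj (a , b) (a′ , b′) ≡ 1 →
        ((a′ ≡ suc a ⊎ suc a′ ≡ a) × b′ ≡ b) ⊎ (a′ ≡ a × (b′ ≡ suc b ⊎ suc b′ ≡ b))
adj≡1 a b a′ b′ e
  with +≡1 ∣ a - a′ ∣ ∣ b - b′ ∣ (ℕ.≡ᵇ⇒≡ _ 1 (T⇒ (∣ a - a′ ∣ ℕ.+ ∣ b - b′ ∣ ≡ᵇ 1) e))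
... | inj₁ (p , q) = inj₁ (∣-∣≡1 a a′ p , sym (ℕ.∣m-n∣≡0⇒m≡n q))
... | inj₂ (p , q) = inj₂ (sym (ℕ.∣m-n∣≡0⇒m≡n p) , ∣-∣≡1 b b′ q)

nbrs₃ : ℕ → ℕ → List (ℕ × ℕ)
nbrs₃ a b = (suc a , b) ∷ (a , suc b) ∷ (a , pred b) ∷ []

nbrs₄ : ℕ → ℕ → List (ℕ × ℕ)
nbrs₄ a b = (pred a , b) ∷ nbrs₃ a b

adj⇒nbrs₄ : ∀ a b y → adj (a , b) y ≡ 1 → y ∈ nbrs₄ a b
adj⇒nbrs₄ a b (a′ , b′) e with adj≡1 a b a′ b′ e
... | inj₁ (inj₁ refl , refl) = there (here refl)
... | inj₁ (inj₂ refl , refl) = here refl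
... | inj₂ (refl , inj₁ refl) = there (there (here refl))
... | inj₂ (refl , inj₂ refl) = there (there (there (here refl)))

adj⇒nbrs₃ : ∀ b y → adj (0 , b) y ≡ 1 → y ∈ nbrs₃ 0 b
adj⇒nbrs₃ b (a′ , b′) e with adj≡1 0 b a′ b′ e
... | inj₁ (inj₁ refl , refl) = here refl
... | inj₂ (refl , inj₁ refl) = there (here refl)
... | inj₂ (refl , inj₂ refl) = there (there (here refl))

module _ {V : Set} (wt : Maybe V → Maybe V → ℕ) (wt-sym : ∀ u v → wt u v ≡ wt v u) where

  reach⇒connected : (∀ v → Star (λ x y → 0 < wt x y) (just v) nothing) →
                    ∀ u v → Star (λ x y → 0 < wt x y) u v
  reach⇒connected r u v =
    r′ u ◅◅ Star.reverse (λ {x} {y} p → subst (0 <_) (wt-sym x y) p) (r′ v)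
    where
    r′ : ∀ u → Star (λ x y → 0 < wt x y) u nothing
    r′ (just u) = r u
    r′ nothing  = Star.ε

-- Indices are shifted: (a , b) : Fin p × Fin q is the vertex (a + 1 , b + 1)
-- of [p] × [q].

module Grid (p q : ℕ) where

  V : Set
  V = Fin p × Fin q

  coords : V → ℕ × ℕ
  coords (a , b) = toℕ a , toℕ b

  gridVertices : List V
  gridVertices = cartesianProduct (allFin p) (allFin q)

  gridDeg : V → ℕ
  gridDeg v = sum (map (λ w → adj (coords v) (coords w)) gridVertices)

  -- The subtraction does not truncate: see gridDeg≤4.

  wt : Maybe V → Maybe V → ℕ
  wt (just v) (just w) = adj (coords v) (coords w)
  wt (just v) nothing  = 4 ∸ gridDeg v
  wt nothing  (just v) = 4 ∸ gridDeg v
  wt nothing  nothing  = 0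

  wt-sym : ∀ u v → wt u v ≡ wt v u
  wt-sym (just v) (just w) = adj-sym (coords v) (coords w)
  wt-sym (just v) nothing  = refl
  wt-sym nothing  (just v) = refl
  wt-sym nothing  nothing  = refl

  unique : Unique gridVertices
  unique = Unique.cartesianProduct⁺ (Unique.allFin⁺ p) (Unique.allFin⁺ q)

  coords-inj : ∀ {v w} → coords v ≡ coords w → v ≡ w
  coords-inj e = cong₂ _,_ (Fin.toℕ-injective (cong proj₁ e))
                           (Fin.toℕ-injective (cong proj₂ e))

  gridDeg≤4 : ∀ v → gridDeg v ≤ 4
  gridDeg≤4 (a , b) = ∑adj≤length coords coords-inj
    (toℕ a , toℕ b) (nbrs₄ (toℕ a) (toℕ b)) (adj⇒nbrs₄ (toℕ a) (toℕ b)) unique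

  reach : ∀ k (a : Fin p) b → toℕ a ≡ k →
          Star (λ x y → 0 < wt x y) (just (a , b)) nothing
  reach zero a b e = ℕ.m<n⇒0<n∸m (s≤s bound) ◅ Star.ε
    where
    bound : gridDeg (a , b) ≤ 3
    bound rewrite e = ∑adj≤length coords coords-inj
      (0 , toℕ b) (nbrs₃ 0 (toℕ b)) (adj⇒nbrs₃ (toℕ b)) unique
  reach (suc k) a b e = ℕ.≤-reflexive (sym step) ◅ reach k a′ b e′
    where
    k<p : k < p
    k<p = ℕ.<-trans (ℕ.≤-reflexive (sym e)) (Fin.toℕ<n a)
    a′ : Fin p
    a′ = fromℕ< k<p
    e′ : toℕ a′ ≡ k
    e′ = Fin.toℕ-fromℕ< k<p
    step : adj (toℕ a , toℕ b) (toℕ a′ , toℕ b) ≡ 1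
    step = trans (cong₂ (λ s t → adj (s , toℕ b) (t , toℕ b)) e e′) (adj-step k (toℕ b))

SΓ : ℕ → ℕ → SandpileGraph
SΓ p q = record
  { Ṽ         = V
  ; vertices  = gridVertices
  ; complete  = λ v → ∈-cartesianProduct⁺ (∈-allFin (proj₁ v)) (∈-allFin (proj₂ v))
  ; unique    = unique
  ; wt        = wt
  ; wt-sym    = wt-sym
  ; connected = reach⇒connected wt wt-sym (λ v → reach _ (proj₁ v) (proj₂ v) refl)
  }
  where open Grid p q

SΓ-deg : ∀ p q v → SandpileGraph.deg (SΓ p q) v ≡ 4
SΓ-deg p q v = ℕ.m+[n∸m]≡n (Grid.gridDeg≤4 p q v)

-- Indices are shifted: (i , j) is the vertex v_{i+1,j+1}.

module Triangle (n : ℕ) where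

  V : Set
  V = Σ (Fin n) λ i → Fin (suc (toℕ i))

  coords : V → ℕ × ℕ
  coords (i , j) = toℕ i , toℕ j

  row : Fin n → List V
  row i = map (i ,_) (allFin (suc (toℕ i)))

  triVertices : List V
  triVertices = concat (map row (allFin n))

  wtSink : V → ℕ
  wtSink (i , j) = if suc (toℕ i) ≡ᵇ n then 1 else 0

  wt : Maybe V → Maybe V → ℕ
  wt (just v) (just w) = adj (coords v) (coords w)
  wt (just v) nothing  = wtSink v
  wt nothing  (just v) = wtSink v
  wt nothing  nothing  = 0

  wt-sym : ∀ u v → wt u v ≡ wt v u
  wt-sym (just v) (just w) = adj-sym (coords v) (coords w)
  wt-sym (just v) nothing  = refl
  wt-sym nothing  (just v) = refl
  wt-sym nothing  nothing  = refl

  complete : ∀ v → v ∈ triVertices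
  complete (i , j) = ∈-concat⁺′ (∈-map⁺ (i ,_) (∈-allFin j)) (∈-map⁺ row (∈-allFin i))

  ∈-row : ∀ {i v} → v ∈ row i → proj₁ v ≡ i
  ∈-row v∈ with ∈-map⁻ _ v∈
  ... | _ , _ , refl = refl

  unique : Unique triVertices
  unique = Unique.concat⁺
    (All.map⁺ (All.universal uniqueRow (allFin n)))
    (AllPairs.map⁺ (AllPairs.map disjoint (Unique.allFin⁺ n)))
    where
    uniqueRow : ∀ i → Unique (row i)
    uniqueRow i = Unique.map⁺ (λ { refl → refl }) (Unique.allFin⁺ _)
    disjoint : ∀ {i j} → i ≢ j → Disjoint (row i) (row j)
    disjoint i≢j (v∈i , v∈j) = i≢j (trans (sym (∈-row v∈i)) (∈-row v∈j))

  reach : ∀ k (i : Fin n) j → suc (toℕ i) ℕ.+ k ≡ n →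
          Star (λ x y → 0 < wt x y) (just (i , j)) nothing
  reach zero i j e = ℕ.≤-reflexive (sym last) ◅ Star.ε
    where
    last : wtSink (i , j) ≡ 1
    last with suc (toℕ i) ≡ᵇ n | ℕ.≡⇒≡ᵇ (suc (toℕ i)) n (trans (sym (ℕ.+-identityʳ _)) e)
    ... | true | _ = refl
  reach (suc k) i j e =
    ℕ.≤-reflexive (sym step) ◅ reach k i′ j′ (trans (cong (λ t → suc t ℕ.+ k) e′) e₁)
    where
    e₁ : suc (suc (toℕ i)) ℕ.+ k ≡ n
    e₁ = trans (sym (ℕ.+-suc (suc (toℕ i)) k)) e
    i<n : suc (toℕ i) < n
    i<n = subst (suc (suc (toℕ i)) ≤_) e₁ (ℕ.m≤m+n _ k)
    i′ : Fin n
    i′ = fromℕ< i<n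
    e′ : toℕ i′ ≡ suc (toℕ i)
    e′ = Fin.toℕ-fromℕ< i<n
    j<  : toℕ j < suc (toℕ i′)
    j< = ℕ.m≤n⇒m≤1+n (subst (toℕ j <_) (sym e′) (Fin.toℕ<n j))
    j′ : Fin (suc (toℕ i′))
    j′ = fromℕ< j<
    step : adj (toℕ i , toℕ j) (toℕ i′ , toℕ j′) ≡ 1
    step = trans
      (cong₂ (λ s t → adj (toℕ i , toℕ j) (s , t)) e′ (Fin.toℕ-fromℕ< j<))
      (trans (adj-sym (toℕ i , toℕ j) (suc (toℕ i) , toℕ j)) (adj-step (toℕ i) (toℕ j)))

P : ℕ → SandpileGraph
P n = record
  { Ṽ         = V
  ; vertices  = triVertices
  ; complete  = complete
  ; unique    = unique
  ; wt        = wt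
  ; wt-sym    = wt-sym
  ; connected = reach⇒connected wt wt-sym
      (λ v → reach _ (proj₁ v) (proj₂ v) (ℕ.m+[n∸m]≡n (Fin.toℕ<n (proj₁ v))))
  }
  where open Triangle n

{-# OPTIONS --safe #-}
module Submission where

-- The operator Δ̃ of the grid is injective (maximum principle), so an integral solution f of
-- Δ̃ f = 2k on the 2n × 2n grid has all the symmetries of the square and is determined by its
-- restriction to a fundamental triangle, which is the vertex set of P n. On such functions
-- the grid operator is Δ̃ of P n off the diagonal and twice Δ̃ of P n on it, so solvability
-- on the grid amounts to k (2⃗ - d) ∈ image Δ̃ on P n, where d is the sum of the diagonal
-- vertices. Finally d = Δ̃ h for h = ∑ (n + 1 - i) v_{i,j}, so this is equivalent to
-- k 2⃗ ∈ image Δ̃ on P n.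

open import Defs
open import Algebra.Bundles using (AbelianGroup)
open import Algebra.Morphism.Structures using (module GroupMorphisms)
open import Data.Bool.Base using (true; false; if_then_else_)
open import Data.Fin.Base using (Fin; toℕ; fromℕ<)
import Data.Fin.Properties as Fin
open import Data.Integer.Base as ℤ using (ℤ; +_; -[1+_])
import Data.Integer.Properties as ℤ
open import Data.Integer.Tactic.RingSolver using (solve-∀)
open import Data.List.Base using (List; []; _∷_; map)
open import Data.List.Membership.Propositional using (_∈_)
open import Data.List.Relation.Unary.All as All using (All; []; _∷_)
open import Data.List.Relation.Unary.AllPairs using (_∷_)
open import Data.List.Relation.Unary.Any using (here; there)
open import Data.List.Relation.Unary.Unique.Propositional using (Unique)
open import Data.Maybe.Base using (just)
open import Data.Nat.Base as ℕ
  using (ℕ; zero; suc; _*_; _≡ᵇ_; ∣_-_∣; _∸_; _⊔_; _⊓_; _≤_; _<_; z≤n; s≤s)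
open import Data.Nat.ListAction using (sum)
import Data.Nat.Properties as ℕ
open import Data.Product.Base using (∃; _×_; _,_; proj₁; proj₂)
open import Data.Sum.Base using (_⊎_; inj₁; inj₂)
open import Function.Base using (_∘_)
open import Relation.Binary.PropositionalEquality
  using (_≡_; _≢_; refl; sym; trans; cong; cong₂; subst)
open import Relation.Nullary using (yes; no; contradiction)

-- Homomorphisms out of a cyclic subgroup.

module _ {a ℓ b ℓ′} (A : AbelianGroup a ℓ) (B : AbelianGroup b ℓ′)
         (g : AbelianGroup.Carrier A) (h : AbelianGroup.Carrier B) where
  private
    module A = AbelianGroup A
    module B = AbelianGroup B
    module C = AbelianGroup (⟨_⟩ A g)
    module ·A = Cyclic A
    module ·B = Cyclic B
    module ·C = Cyclic (⟨_⟩ A g)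
  open GroupMorphisms C.rawGroup B.rawGroup

  ·-generator⁺ : ∀ n → proj₁ ((+ n) ·C.· generator A g) ≡ (+ n) ·A.· g
  ·-generator⁺ zero    = refl
  ·-generator⁺ (suc n) = cong (g A.∙_) (·-generator⁺ n)

  -- Lets every element `(x , k , p)` of the subgroup be replaced by a multiple of the generator, on
  -- which any homomorphism is known; uniqueness of `ψ` rests on this.
  ·-generator : ∀ k → proj₁ (k ·C.· generator A g) ≡ k ·A.· g
  ·-generator (+ n)    = ·-generator⁺ n
  ·-generator -[1+ n ] = cong A._⁻¹ (·-generator⁺ (suc n))

  module _ {φ : C.Carrier → B.Carrier} (φ-homo : IsGroupHomomorphism φ)
           (φ-gen : φ (generator A g) B.≈ h) where
    open IsGroupHomomorphism φ-homo

    homo-·⁺ : ∀ n → φ ((+ n) ·C.· generator A g) B.≈ (+ n) ·B.· h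
    homo-·⁺ zero    = ε-homo
    homo-·⁺ (suc n) = B.trans (homo (generator A g) ((+ n) ·C.· generator A g))
      (B.∙-cong φ-gen (homo-·⁺ n))

    homo-· : ∀ k → φ (k ·C.· generator A g) B.≈ k ·B.· h
    homo-· (+ n)    = homo-·⁺ n
    homo-· -[1+ n ] = B.trans (⁻¹-homo ((+ suc n) ·C.· generator A g))
      (B.⁻¹-cong (homo-·⁺ (suc n)))

  -- `ψ` reads off the exponent stored in the membership witness. The first hypothesis makes the
  -- result independent of that witness, the second makes `ψ` injective.
  cyclic-monomorphism :
    (∀ k l → k ·A.· g A.≈ l ·A.· g → k ·B.· h B.≈ l ·B.· h) →
    (∀ k l → k ·B.· h B.≈ l ·B.· h → k ·A.· g A.≈ l ·A.· g) →
    ∃ λ (ψ : C.Carrier → B.Carrier) →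
      ψ (generator A g) B.≈ h ×
      IsGroupMonomorphism ψ ×
      ((φ : C.Carrier → B.Carrier) → IsGroupHomomorphism φ →
        φ (generator A g) B.≈ h → (x : C.Carrier) → φ x B.≈ ψ x)
  cyclic-monomorphism to from = ψ , B.identityʳ h , ψ-mono , ψ-unique
    where
    ψ : C.Carrier → B.Carrier
    ψ (_ , k , _) = k ·B.· h

    ψ-mono : IsGroupMonomorphism ψ
    ψ-mono = record
      { isGroupHomomorphism = record
        { isMonoidHomomorphism = record
          { isMagmaHomomorphism = record
            { isRelHomomorphism = record
              { cong = λ { {_ , k , p} {_ , l , q} x≈y →
                  to k l (A.trans (A.sym p) (A.trans x≈y q)) }
              }
            ; homo = λ { (_ , k , _) (_ , l , _) → ·B.·-+ k l h }
            }
          ; ε-homo = B.refl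
          }
        ; ⁻¹-homo = λ { (_ , k , _) → ·B.·-neg k h }
        }
      ; injective = λ { {_ , k , p} {_ , l , q} e →
          A.trans p (A.trans (from k l e) (A.sym q)) }
      }

    ψ-unique : (φ : C.Carrier → B.Carrier) → IsGroupHomomorphism φ →
      φ (generator A g) B.≈ h → (x : C.Carrier) → φ x B.≈ ψ x
    ψ-unique φ φ-homo φ-gen (_ , k , p) = B.trans
      (IsGroupHomomorphism.⟦⟧-cong φ-homo
        (A.trans p (A.reflexive (sym (·-generator k)))))
      (homo-· φ-homo φ-gen k)

-- Integer multiples in a sandpile group.

module _ (G : SandpileGraph) where
  open SandpileGraph G
  open Cyclic (𝒮 G) using (_·_)

  ·-coefficient : ∀ k x v → (k · x) v ≡ k ℤ.* x v
  ·-coefficient (+ n)    x v = times n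
    where
    times : ∀ n → ((+ n) · x) v ≡ (+ n) ℤ.* x v
    times zero    = refl
    times (suc n) = trans (cong (λ t → x v ℤ.+ t) (times n)) (sym (ℤ.suc-* (+ n) (x v)))
  ·-coefficient -[1+ n ] x v = trans (cong ℤ.-_ (·-coefficient (+ suc n) x v))
    (ℤ.neg-distribˡ-* (+ suc n) (x v))

  ·-difference : ∀ k l x v → (k · x) v ℤ.- (l · x) v ≡ (k ℤ.- l) ℤ.* x v
  ·-difference k l x v = trans
    (cong₂ ℤ._-_ (·-coefficient k x v) (·-coefficient l x v)) (factor k l (x v))
    where
    factor : ∀ a b c → a ℤ.* c ℤ.- b ℤ.* c ≡ (a ℤ.- b) ℤ.* c
    factor = solve-∀

-- Kronecker deltas, finite sums and extension by zero.

dirac : ℕ → ℕ → ℕ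
dirac m n = if m ≡ᵇ n then 1 else 0

dirac² : ℕ × ℕ → ℕ × ℕ → ℕ
dirac² (a , b) (c , d) = dirac a c ℕ.* dirac b d

dirac-distance : ∀ m n → (if ∣ m - n ∣ ≡ᵇ 0 then 1 else 0) ≡ dirac m n
dirac-distance zero    zero    = refl
dirac-distance zero    (suc n) = refl
dirac-distance (suc m) zero    = refl
dirac-distance (suc m) (suc n) = dirac-distance m n

dirac-neighbours : ∀ m n → (if ∣ m - suc n ∣ ≡ᵇ 1 then 1 else 0) ≡
                           dirac m n ℕ.+ dirac m (suc (suc n))
dirac-neighbours zero          zero    = refl
dirac-neighbours zero          (suc n) = refl
dirac-neighbours (suc zero)    zero    = refl
dirac-neighbours (suc (suc zero))    zero = refl
dirac-neighbours (suc (suc (suc m))) zero = refl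
dirac-neighbours (suc m)       (suc n) = dirac-neighbours m n

-- Both sides are unchanged when the two first coordinates drop by one, so the induction ends at a
-- few small first coordinates, one for each possible horizontal distance 0, 1 or more.
adj-dirac² : ∀ x a b → adj x (suc a , suc b) ≡
  (dirac² x (a , suc b) ℕ.+ dirac² x (suc (suc a) , suc b)) ℕ.+
  (dirac² x (suc a , b) ℕ.+ dirac² x (suc a , suc (suc b)))
adj-dirac² (zero , b′)  zero b
  rewrite dirac-distance b′ (suc b) | ℕ.+-identityʳ (dirac b′ (suc b))
        | ℕ.+-identityʳ (dirac b′ (suc b)) = sym (ℕ.+-identityʳ (dirac b′ (suc b)))
adj-dirac² (zero , b′)  (suc a) b = refl
adj-dirac² (suc zero , b′) zero b
  rewrite ℕ.+-identityʳ (dirac b′ b)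
        | ℕ.+-identityʳ (dirac b′ (suc (suc b))) = dirac-neighbours b′ b
adj-dirac² (suc (suc zero) , b′) zero b
  rewrite dirac-distance b′ (suc b) | ℕ.+-identityʳ (dirac b′ (suc b))
  = sym (ℕ.+-identityʳ (dirac b′ (suc b)))
adj-dirac² (suc (suc (suc a′)) , b′) zero b = refl
adj-dirac² (suc a′ , b′) (suc a) b = adj-dirac² (a′ , b′) a b

dirac-refl : ∀ m → dirac m m ≡ 1
dirac-refl zero    = refl
dirac-refl (suc m) = dirac-refl m

dirac-≢ : ∀ {m n} → m ≢ n → dirac m n ≡ 0
dirac-≢ {zero}  {zero}  m≢n = contradiction refl m≢n
dirac-≢ {zero}  {suc n} m≢n = refl
dirac-≢ {suc m} {zero}  m≢n = refl
dirac-≢ {suc m} {suc n} m≢n = dirac-≢ {m} {n} λ e → m≢n (cong suc e)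

dirac²-refl : ∀ x → dirac² x x ≡ 1
dirac²-refl (a , b) = cong₂ ℕ._*_ (dirac-refl a) (dirac-refl b)

dirac²-≢ : ∀ {x y} → x ≢ y → dirac² x y ≡ 0
dirac²-≢ {a , b} {c , d} x≢y with a ℕ.≟ c
... | no a≢c   = cong (ℕ._* dirac b d) (dirac-≢ a≢c)
... | yes refl = trans
  (cong (dirac a a ℕ.*_) (dirac-≢ λ b≡d → x≢y (cong (a ,_) b≡d)))
  (ℕ.*-zeroʳ (dirac a a))

∑-cong : {A : Set} (xs : List A) {f g : A → ℤ} → (∀ x → f x ≡ g x) → ∑ xs f ≡ ∑ xs g
∑-cong []       e = refl
∑-cong (x ∷ xs) e = cong₂ ℤ._+_ (e x) (∑-cong xs e)

∑-zero : {A : Set} {f : A → ℤ} {xs : List A} → All (λ x → f x ≡ + 0) xs → ∑ xs f ≡ + 0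
∑-zero []       = refl
∑-zero (e ∷ es) = cong₂ ℤ._+_ e (∑-zero es)

∑-single : {A : Set} {f : A → ℤ} {xs : List A} {x : A} → Unique xs → x ∈ xs →
           (∀ {y} → x ≢ y → f y ≡ + 0) → ∑ xs f ≡ f x
∑-single {f = f} {y ∷ _} (y∉ ∷ _) (here refl) zero-off =
  trans (cong (λ t → f y ℤ.+ t) (∑-zero (All.map zero-off y∉))) (ℤ.+-identityʳ (f y))
∑-single {f = f} {y ∷ _} {x} (y∉ ∷ u) (there x∈) zero-off =
  trans (cong₂ ℤ._+_ (zero-off λ { refl → All.lookup y∉ x∈ refl })
                     (∑-single u x∈ zero-off))
        (ℤ.+-identityˡ (f x))

sum-∑ : {A : Set} (xs : List A) (f : A → ℕ) → + sum (map f xs) ≡ ∑ xs (λ x → + f x)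
sum-∑ []       f = refl
sum-∑ (x ∷ xs) f = cong (λ t → + f x ℤ.+ t) (sum-∑ xs f)

-- Neighbours of (a + 1 , b + 1): the shift avoids the predecessors of 0.
neighbourSum : (ℕ × ℕ → ℤ) → ℕ → ℕ → ℤ
neighbourSum F a b =
  (F (a , suc b) ℤ.+ F (suc (suc a) , suc b)) ℤ.+
  (F (suc a , b) ℤ.+ F (suc a , suc (suc b)))

module ZeroExtension {V : Set} (vs : List V) (complete : ∀ v → v ∈ vs) (unique : Unique vs)
         (c : V → ℕ × ℕ) (c-inj : ∀ {v w} → c v ≡ c w → v ≡ w) where

  -- Extension by zero, written as a sum of point masses: no decision whether `y` is a vertex is
  -- needed, and the sums in `Δ̃` become values of `ext` by linearity.
  ext : (V → ℤ) → ℕ × ℕ → ℤ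
  ext f y = ∑ vs (λ v → f v ℤ.* + dirac² (c v) y)

  ext-inside : ∀ f v → ext f (c v) ≡ f v
  ext-inside f v = trans
    (∑-single unique (complete v) λ {w} v≢w → trans
      (cong (λ t → f w ℤ.* + t) (dirac²-≢ λ e → v≢w (sym (c-inj e))))
      (ℤ.*-zeroʳ (f w)))
    (trans (cong (λ t → f v ℤ.* + t) (dirac²-refl (c v))) (ℤ.*-identityʳ (f v)))

  ext-outside : ∀ f y → (∀ v → c v ≢ y) → ext f y ≡ + 0
  ext-outside f y y∉ = ∑-zero (All.universal
    (λ v → trans (cong (λ t → f v ℤ.* + t) (dirac²-≢ (y∉ v))) (ℤ.*-zeroʳ (f v))) vs)

  ∑-adj : ∀ f a b → ∑ vs (λ v → f v ℤ.* + adj (c v) (suc a , suc b)) ≡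
                    neighbourSum (ext f) a b
  ∑-adj f a b = trans
    (∑-+ vs (λ v → term l v ℤ.+ term r v) (λ v → term d v ℤ.+ term u v) _
      λ v → trans (cong (λ t → f v ℤ.* + t) (adj-dirac² (c v) a b))
        (distribute (f v) (+ at l v) (+ at r v) (+ at d v) (+ at u v)))
    (cong₂ ℤ._+_ (∑-+ vs (term l) (term r) _ λ _ → refl)
                 (∑-+ vs (term d) (term u) _ λ _ → refl))
    where
    l r d u : ℕ × ℕ
    l = a , suc b
    r = suc (suc a) , suc b
    d = suc a , b
    u = suc a , suc (suc b)
    at : ℕ × ℕ → V → ℕ
    at y v = dirac² (c v) y
    term : ℕ × ℕ → V → ℤ
    term y v = f v ℤ.* + at y v
    distribute : ∀ t p q r s → t ℤ.* ((p ℤ.+ q) ℤ.+ (r ℤ.+ s)) ≡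
      (t ℤ.* p ℤ.+ t ℤ.* q) ℤ.+ (t ℤ.* r ℤ.+ t ℤ.* s)
    distribute = solve-∀

  -- Counts the non-sink neighbours for the degree: `ext (λ _ → + 1)` is the indicator function of
  -- the vertex set.
  sum-adj : ∀ a b → + sum (map (λ w → adj (suc a , suc b) (c w)) vs) ≡
                    neighbourSum (ext (λ _ → + 1)) a b
  sum-adj a b = trans (sum-∑ vs _) (trans
    (∑-cong vs λ w → trans (cong +_ (adj-sym (suc a , suc b) (c w))) (sym (ℤ.*-identityˡ _)))
    (∑-adj (λ _ → + 1) a b))

-- The five-point Laplacian and the maximum principle.

laplacian : (ℕ × ℕ → ℤ) → ℕ → ℕ → ℤ
laplacian F a b = + 4 ℤ.* F (suc a , suc b) ℤ.- neighbourSum F a b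

record Dirichlet (N : ℕ) (F : ℕ × ℕ → ℤ) : Set where
  field
    left   : ∀ b → F (0 , b) ≡ + 0
    bottom : ∀ a → F (a , 0) ≡ + 0
    right  : ∀ {a} → N < a → ∀ b → F (a , b) ≡ + 0
    top    : ∀ {b} → N < b → ∀ a → F (a , b) ≡ + 0

argmax : (f : ℕ → ℤ) (n : ℕ) → ∃ λ m → ∀ k → k ≤ n → f k ℤ.≤ f m
argmax f zero    = 0 , λ { zero z≤n → ℤ.≤-refl }
argmax f (suc n) with argmax f n
... | m , max with ℤ.≤-total (f m) (f (suc n))
...   | inj₁ m≤n = suc n , λ k k≤ → below k (ℕ.m≤n⇒m<n∨m≡n k≤)
  where
  below : ∀ k → k < suc n ⊎ k ≡ suc n → f k ℤ.≤ f (suc n)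
  below k (inj₁ (s≤s k≤n)) = ℤ.≤-trans (max k k≤n) m≤n
  below k (inj₂ refl)      = ℤ.≤-refl
...   | inj₂ n≤m = m , λ k k≤ → below k (ℕ.m≤n⇒m<n∨m≡n k≤)
  where
  below : ∀ k → k < suc n ⊎ k ≡ suc n → f k ℤ.≤ f m
  below k (inj₁ (s≤s k≤n)) = max k k≤n
  below k (inj₂ refl)      = n≤m

module _ {N : ℕ} {F : ℕ × ℕ → ℤ} (F-dir : Dirichlet N F)
         (harmonic : ∀ {a b} → a < N → b < N → laplacian F a b ≡ + 0) where
  open Dirichlet F-dir

  -- At an interior maximum all neighbours attain the maximum too, so one can walk left
  -- until the boundary.
  maximum≤0 : ∀ a b → (∀ a′ b′ → a′ ≤ suc N → b′ ≤ suc N → F (a′ , b′) ℤ.≤ F (a , b)) →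
              F (a , b) ℤ.≤ + 0
  maximum≤0 zero    b       max = ℤ.≤-reflexive (left b)
  maximum≤0 (suc a) zero    max = ℤ.≤-reflexive (bottom (suc a))
  maximum≤0 (suc a) (suc b) max with suc a ℕ.≤? N | suc b ℕ.≤? N
  ... | no a≮N  | _       = ℤ.≤-reflexive (right (ℕ.≰⇒> a≮N) (suc b))
  ... | yes _   | no b≮N  = ℤ.≤-reflexive (top (ℕ.≰⇒> b≮N) (suc a))
  ... | yes a<N | yes b<N = ℤ.≤-trans centre≤left
    (maximum≤0 a (suc b) λ a′ b′ p q → ℤ.≤-trans (max a′ b′ p q) centre≤left)
    where
    slack : ∀ {a′ b′} → a′ ≤ suc N → b′ ≤ suc N →
            + 0 ℤ.≤ F (suc a , suc b) ℤ.- F (a′ , b′)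
    slack p q = ℤ.i≤j⇒0≤j-i (max _ _ p q)
    rearrange : ∀ m l r d u → l ℤ.- m ≡
      ((m ℤ.- r) ℤ.+ ((m ℤ.- d) ℤ.+ (m ℤ.- u))) ℤ.-
        (+ 4 ℤ.* m ℤ.- ((l ℤ.+ r) ℤ.+ (d ℤ.+ u)))
    rearrange = solve-∀
    subtract-zero : ∀ s {t} → t ≡ + 0 → s ℤ.- t ≡ s
    subtract-zero s refl = ℤ.+-identityʳ s
    a≤ : a ≤ suc N
    a≤ = ℕ.m≤n⇒m≤1+n (ℕ.<⇒≤ a<N)
    b≤ : b ≤ suc N
    b≤ = ℕ.m≤n⇒m≤1+n (ℕ.<⇒≤ b<N)
    -- By `rearrange`, the left value minus the centre is the sum of the slacks of the other three
    -- neighbours, up to the vanishing Laplacian, and slacks at a maximum are nonnegative.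
    centre≤left : F (suc a , suc b) ℤ.≤ F (a , suc b)
    centre≤left = ℤ.0≤i-j⇒j≤i (subst (+ 0 ℤ.≤_)
      (sym (trans (rearrange _ (F (a , suc b)) (F (suc (suc a) , suc b))
                             (F (suc a , b)) (F (suc a , suc (suc b))))
           (subtract-zero _ (harmonic a<N b<N))))
      (ℤ.+-mono-≤ (slack (s≤s a<N) (s≤s (ℕ.<⇒≤ b<N)))
        (ℤ.+-mono-≤ (slack (s≤s (ℕ.<⇒≤ a<N)) b≤) (slack (s≤s (ℕ.<⇒≤ a<N)) (s≤s b<N)))))

  -- Inside the square up to `suc N` a maximum is found by two nested searches and bounded by
  -- `maximum≤0`; beyond the square `F` vanishes.
  harmonic≤0 : ∀ a b → F (a , b) ℤ.≤ + 0
  harmonic≤0 a b with a ℕ.≤? suc N | b ℕ.≤? suc N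
  ... | no a≰   | _       = ℤ.≤-reflexive (right (ℕ.<-trans (ℕ.n<1+n N) (ℕ.≰⇒> a≰)) b)
  ... | yes _   | no b≰   = ℤ.≤-reflexive (top (ℕ.<-trans (ℕ.n<1+n N) (ℕ.≰⇒> b≰)) a)
  ... | yes a≤  | yes b≤  = ℤ.≤-trans (max a b a≤ b≤) (maximum≤0 a₀ (b₀ a₀) max)
    where
    b₀ : ℕ → ℕ
    b₀ a = proj₁ (argmax (λ b → F (a , b)) (suc N))
    a₀ : ℕ
    a₀ = proj₁ (argmax (λ a → F (a , b₀ a)) (suc N))
    max : ∀ a′ b′ → a′ ≤ suc N → b′ ≤ suc N → F (a′ , b′) ℤ.≤ F (a₀ , b₀ a₀)
    max a′ b′ p q = ℤ.≤-trans (proj₂ (argmax (λ b → F (a′ , b)) (suc N)) b′ q)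
                              (proj₂ (argmax (λ a → F (a , b₀ a)) (suc N)) a′ p)

-- Uniqueness and symmetry of Dirichlet solutions.

laplacian-difference : ∀ F G a b → laplacian (λ y → F y ℤ.- G y) a b ≡
                       laplacian F a b ℤ.- laplacian G a b
laplacian-difference F G a b = lem (F (suc a , suc b)) (G (suc a , suc b))
  (F (a , suc b)) (G (a , suc b)) (F (suc (suc a) , suc b)) (G (suc (suc a) , suc b))
  (F (suc a , b)) (G (suc a , b)) (F (suc a , suc (suc b))) (G (suc a , suc (suc b)))
  where
  lem : ∀ m m′ l l′ r r′ d d′ u u′ →
    + 4 ℤ.* (m ℤ.- m′) ℤ.- (((l ℤ.- l′) ℤ.+ (r ℤ.- r′)) ℤ.+ ((d ℤ.- d′) ℤ.+ (u ℤ.- u′)))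
    ≡ (+ 4 ℤ.* m ℤ.- ((l ℤ.+ r) ℤ.+ (d ℤ.+ u))) ℤ.-
      (+ 4 ℤ.* m′ ℤ.- ((l′ ℤ.+ r′) ℤ.+ (d′ ℤ.+ u′)))
  lem = solve-∀

module _ {N : ℕ} where

  Dirichlet-difference : ∀ {F G} → Dirichlet N F → Dirichlet N G →
                         Dirichlet N (λ y → F y ℤ.- G y)
  Dirichlet-difference F-dir G-dir = record
    { left   = λ b → cong₂ ℤ._-_ (F.left b) (G.left b)
    ; bottom = λ a → cong₂ ℤ._-_ (F.bottom a) (G.bottom a)
    ; right  = λ p b → cong₂ ℤ._-_ (F.right p b) (G.right p b)
    ; top    = λ p a → cong₂ ℤ._-_ (F.top p a) (G.top p a)
    }
    where
    module F = Dirichlet F-dir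
    module G = Dirichlet G-dir

  -- The difference is harmonic with zero boundary values, so the maximum principle applies to it;
  -- using both orders gives uniqueness.
  dirichlet-≤ : ∀ {F G} → Dirichlet N F → Dirichlet N G →
    (∀ {a b} → a < N → b < N → laplacian F a b ≡ laplacian G a b) → ∀ y → F y ℤ.≤ G y
  dirichlet-≤ {F} {G} F-dir G-dir e (a , b) = ℤ.i-j≤0⇒i≤j (harmonic≤0
    (Dirichlet-difference F-dir G-dir)
    (λ {a} {b} p q → trans (laplacian-difference F G a b) (ℤ.i≡j⇒i-j≡0 (e p q))) a b)

  dirichlet-unique : ∀ {F G} → Dirichlet N F → Dirichlet N G →
    (∀ {a b} → a < N → b < N → laplacian F a b ≡ laplacian G a b) → ∀ y → F y ≡ G y
  dirichlet-unique F-dir G-dir e y = ℤ.≤-antisym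
    (dirichlet-≤ F-dir G-dir e y) (dirichlet-≤ G-dir F-dir (λ p q → sym (e p q)) y)

  transpose : ∀ {F} → Dirichlet N F → Dirichlet N (λ (a , b) → F (b , a))
  transpose F-dir = record
    { left = bottom ; bottom = left ; right = top ; top = right }
    where open Dirichlet F-dir

  reflect : ∀ {F} → Dirichlet N F → Dirichlet N (λ (a , b) → F (suc N ∸ a , b))
  reflect {F} F-dir = record
    { left   = right ℕ.≤-refl
    ; bottom = λ a → bottom (suc N ∸ a)
    ; right  = λ N<a b → trans (cong (λ t → F (t , b)) (ℕ.m≤n⇒m∸n≡0 N<a)) (left b)
    ; top    = λ N<b a → top N<b (suc N ∸ a)
    }
    where open Dirichlet F-dir

  module _ {F : ℕ × ℕ → ℤ} (F-dir : Dirichlet N F) {K : ℤ}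
           (e : ∀ {a b} → a < N → b < N → laplacian F a b ≡ K) where

    -- A constant right-hand side is invariant under transposition, so the transposed function
    -- solves the same problem and uniqueness applies. The same argument works for the reflection
    -- below.
    constant-symmetric : ∀ a b → F (a , b) ≡ F (b , a)
    constant-symmetric a b = dirichlet-unique F-dir (transpose F-dir)
      (λ {a} {b} p q → trans (e p q) (trans (sym (e q p))
        (swap (F (suc b , suc a)) (F (b , suc a) ℤ.+ F (suc (suc b) , suc a))
              (F (suc b , a) ℤ.+ F (suc b , suc (suc a))))))
      (a , b)
      where
      swap : ∀ m s t → + 4 ℤ.* m ℤ.- (s ℤ.+ t) ≡ + 4 ℤ.* m ℤ.- (t ℤ.+ s)
      swap = solve-∀

    constant-reflect : ∀ a b → F (a , b) ≡ F (suc N ∸ a , b)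
    constant-reflect a b = dirichlet-unique F-dir (reflect F-dir)
      (λ {a} {b} p q → trans (e p q) (sym (laplacian-reflect p q))) (a , b)
      where
      swap : ∀ m l r s → + 4 ℤ.* m ℤ.- ((r ℤ.+ l) ℤ.+ s) ≡ + 4 ℤ.* m ℤ.- ((l ℤ.+ r) ℤ.+ s)
      swap = solve-∀
      laplacian-reflect : ∀ {a b} → a < N → b < N →
        laplacian (λ (a , b) → F (suc N ∸ a , b)) a b ≡ K
      laplacian-reflect {a} {b} a<N b<N
        -- With `t = N ∸ suc a` the three first coordinates become `t + 2`, `t + 1` and `t`: this is
        -- the Laplacian of `F` at index `t` with left and right exchanged.
        rewrite ℕ.+-∸-assoc 1 (ℕ.<⇒≤ a<N) | ℕ.+-∸-assoc 1 a<N
        = trans (swap (F (suc (N ∸ suc a) , suc b)) (F (N ∸ suc a , suc b)) _ _)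
                (e {N ∸ suc a} {b} (ℕ.∸-monoʳ-< {N} {suc a} {0} (s≤s z≤n) a<N) b<N)

neighbourSum-cong : ∀ {F G : ℕ × ℕ → ℤ} → (∀ y → F y ≡ G y) → ∀ a b →
                    neighbourSum F a b ≡ neighbourSum G a b
neighbourSum-cong e a b = cong₂ ℤ._+_ (cong₂ ℤ._+_ (e _) (e _)) (cong₂ ℤ._+_ (e _) (e _))

laplacian-cong : ∀ {F G : ℕ × ℕ → ℤ} → (∀ y → F y ≡ G y) → ∀ a b →
                 laplacian F a b ≡ laplacian G a b
laplacian-cong e a b = cong₂ (λ s t → + 4 ℤ.* s ℤ.- t) (e _) (neighbourSum-cong e a b)

laplacian-symmetric : ∀ {F : ℕ × ℕ → ℤ} → (∀ x y → F (x , y) ≡ F (y , x)) → ∀ a b →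
                      laplacian F a b ≡ laplacian F b a
laplacian-symmetric {F} e a b = trans (laplacian-cong (λ (x , y) → e x y) a b)
  (swap (F (suc b , suc a)) (F (suc b , a) ℤ.+ F (suc b , suc (suc a)))
        (F (b , suc a) ℤ.+ F (suc (suc b) , suc a)))
  where
  swap : ∀ m s t → + 4 ℤ.* m ℤ.- (s ℤ.+ t) ≡ + 4 ℤ.* m ℤ.- (t ℤ.+ s)
  swap = solve-∀

-- The grid operator as the five-point Laplacian.

module GridLaplacian (N : ℕ) where
  open Grid N N hiding (unique)
  open SandpileGraph (SΓ N N) using (Δ̃; complete; unique)

  position : V → ℕ × ℕ
  position (a , b) = suc (toℕ a) , suc (toℕ b)

  position-injective : ∀ {v w} → position v ≡ position w → v ≡ w
  position-injective e = cong₂ _,_ (Fin.toℕ-injective (ℕ.suc-injective (cong proj₁ e)))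
                                   (Fin.toℕ-injective (ℕ.suc-injective (cong proj₂ e)))

  open ZeroExtension gridVertices complete unique position position-injective public

  -- The sink edges bring every degree to 4, and the sink counts as a neighbour of value 0, as does
  -- every point outside the grid for `ext f`.
  Δ̃-laplacian : ∀ f v → Δ̃ f v ≡ laplacian (ext f) (toℕ (proj₁ v)) (toℕ (proj₂ v))
  Δ̃-laplacian f v = cong₂ ℤ._-_
    (cong₂ (λ d t → + d ℤ.* t) (SΓ-deg N N v) (sym (ext-inside f v)))
    (∑-adj f (toℕ (proj₁ v)) (toℕ (proj₂ v)))

  ext-dirichlet : ∀ f → Dirichlet N (ext f)
  ext-dirichlet f = record
    { left   = λ b → ext-outside f (0 , b) λ _ ()
    ; bottom = λ a → ext-outside f (a , 0) λ _ ()
    ; right  = λ {a} N<a b → ext-outside f (a , b) λ { (a , _) refl → ℕ.<⇒≱ N<a (Fin.toℕ<n a) }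
    ; top    = λ {b} N<b a → ext-outside f (a , b) λ { (_ , b) refl → ℕ.<⇒≱ N<b (Fin.toℕ<n b) }
    }

  vertexAt : ∀ {a b} → a < N → b < N → V
  vertexAt p q = fromℕ< p , fromℕ< q

  position-vertexAt : ∀ {a b} (p : a < N) (q : b < N) →
                      position (vertexAt p q) ≡ (suc a , suc b)
  position-vertexAt p q = cong₂ (λ s t → suc s , suc t) (Fin.toℕ-fromℕ< p) (Fin.toℕ-fromℕ< q)

  ext-restrict : ∀ {F} → Dirichlet N F → ∀ y → ext (F ∘ position) y ≡ F y
  ext-restrict {F} F-dir = agree
    where
    module F = Dirichlet F-dir
    module Ext = Dirichlet (ext-dirichlet (F ∘ position))
    agree : ∀ y → ext (F ∘ position) y ≡ F y
    agree (zero , b)     = trans (Ext.left b) (sym (F.left b))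
    agree (suc a , zero) = trans (Ext.bottom (suc a)) (sym (F.bottom (suc a)))
    agree (suc a , suc b) with suc a ℕ.≤? N | suc b ℕ.≤? N
    ... | no a≮N | _      = trans (Ext.right (ℕ.≰⇒> a≮N) (suc b))
                                  (sym (F.right (ℕ.≰⇒> a≮N) (suc b)))
    ... | yes _  | no b≮N = trans (Ext.top (ℕ.≰⇒> b≮N) (suc a))
                                  (sym (F.top (ℕ.≰⇒> b≮N) (suc a)))
    ... | yes p  | yes q  =
      subst (λ y → ext (F ∘ position) y ≡ F y) (position-vertexAt p q)
            (ext-inside (F ∘ position) (vertexAt p q))

  Δ̃-restrict : ∀ {F} → Dirichlet N F → ∀ v →
    Δ̃ (F ∘ position) v ≡ laplacian F (toℕ (proj₁ v)) (toℕ (proj₂ v))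
  Δ̃-restrict {F} F-dir v = trans (Δ̃-laplacian (F ∘ position) v)
    (laplacian-cong (ext-restrict F-dir) _ _)

  laplacian-constant : ∀ f {K} → (∀ v → Δ̃ f v ≡ K) → ∀ {a b} → a < N → b < N →
                       laplacian (ext f) a b ≡ K
  laplacian-constant f e p q = trans
    (sym (cong₂ (laplacian (ext f)) (Fin.toℕ-fromℕ< p) (Fin.toℕ-fromℕ< q)))
    (trans (sym (Δ̃-laplacian f (vertexAt p q))) (e (vertexAt p q)))

-- Folding the grid onto a quadrant.

-- A D₄-symmetric function on the 2n × 2n grid, as a function of the distances x , y ≥ 1
-- to the two axes between the middle rows and columns; distance 0 is the mirror image of
-- distance 1, and distance n + 1 is outside the grid.
record Folded (n : ℕ) (H : ℕ × ℕ → ℤ) : Set where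
  field
    symmetric : ∀ x y → H (x , y) ≡ H (y , x)
    mirror    : ∀ x → H (suc x , 0) ≡ H (suc x , 1)
    vanish    : ∀ {x} → n < x → ∀ y → H (x , y) ≡ + 0

module _ (n : ℕ) where

  -- One of the two summands is always truncated to 0.
  fold : ℕ → ℕ
  fold a = (a ∸ n) ℕ.+ (suc n ∸ a)

  fold² : ℕ × ℕ → ℕ × ℕ
  fold² (a , b) = fold a , fold b

  fold-right : ∀ x → fold (suc x ℕ.+ n) ≡ suc x
  fold-right x = trans
    (cong₂ ℕ._+_ (ℕ.m+n∸n≡m (suc x) n) (ℕ.m≤n⇒m∸n≡0 (s≤s (ℕ.m≤n+m n x))))
    (ℕ.+-identityʳ (suc x))

  fold-left : ∀ a x → a ℕ.+ x ≡ n → fold a ≡ suc x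
  fold-left a x refl = cong₂ ℕ._+_ (ℕ.m≤n⇒m∸n≡0 (ℕ.m≤m+n a x))
    (trans (cong (_∸ a) (sym (ℕ.+-suc a x))) (ℕ.m+n∸m≡n a (suc x)))

  -- The neighbours of a point at distance `suc x` lie at distances `x` and `suc (suc x)`, in either
  -- order; `fold` never takes the value 0, hence the test functions `h` with `h 0 ≡ h 1`.
  FoldedNeighbours : ℕ → Set
  FoldedNeighbours a = ∃ λ x → x < n × fold (suc a) ≡ suc x ×
    ((h : ℕ → ℤ) → h 0 ≡ h 1 → h (fold a) ℤ.+ h (fold (suc (suc a))) ≡ h x ℤ.+ h (suc (suc x)))

  fold-neighboursʳ : ∀ x → x < n → FoldedNeighbours (x ℕ.+ n)
  fold-neighboursʳ x x<n = x , x<n , fold-right x , λ h h0≡h1 →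
    cong₂ ℤ._+_ (previous x h h0≡h1) (cong h (fold-right (suc x)))
    where
    previous : ∀ x (h : ℕ → ℤ) → h 0 ≡ h 1 → h (fold (x ℕ.+ n)) ≡ h x
    -- Next to the axis the neighbour is `n`, across the axis, which folds to 1 instead of 0.
    previous zero    h h0≡h1 = trans (cong h (fold-left n 0 (ℕ.+-identityʳ n))) (sym h0≡h1)
    previous (suc x) h _     = cong h (fold-right x)

  fold-neighboursˡ : ∀ a x → suc a ℕ.+ x ≡ n → FoldedNeighbours a
  fold-neighboursˡ a x e = x , subst (x <_) e (s≤s (ℕ.m≤n+m x a)) , fold-left (suc a) x e ,
    -- On the left half the distance decreases as the coordinate grows, so the two neighbours come
    -- in the opposite order.
    λ h h0≡h1 → trans
      (cong₂ ℤ._+_ (cong h (fold-left a (suc x) (trans (ℕ.+-suc a x) e))) (next x e h h0≡h1))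
      (ℤ.+-comm (h (suc (suc x))) (h x))
    where
    next : ∀ x → suc a ℕ.+ x ≡ n → (h : ℕ → ℤ) → h 0 ≡ h 1 → h (fold (suc (suc a))) ≡ h x
    next zero e h h0≡h1 = trans
      (cong h (trans (cong (fold ∘ suc) (trans (sym (ℕ.+-identityʳ (suc a))) e)) (fold-right 0)))
      (sym h0≡h1)
    next (suc x) e h _  = cong h (fold-left (suc (suc a)) x (trans (sym (ℕ.+-suc (suc a) x)) e))

  fold-neighbours : ∀ a → a < n ℕ.+ n → FoldedNeighbours a
  fold-neighbours a a<2n with n ℕ.≤? a
  ... | yes n≤a = subst FoldedNeighbours (ℕ.m∸n+n≡m n≤a)
    (fold-neighboursʳ (a ∸ n) (ℕ.+-cancelʳ-< n (a ∸ n) n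
      (subst (_< n ℕ.+ n) (sym (ℕ.m∸n+n≡m n≤a)) a<2n)))
  ... | no n≰a  = fold-neighboursˡ a (n ∸ suc a) (ℕ.m+[n∸m]≡n (ℕ.≰⇒> n≰a))

  fold-zero : fold 0 ≡ suc n
  fold-zero = cong (ℕ._+ suc n) (ℕ.0∸n≡0 n)

  fold-large : ∀ {a} → n ℕ.+ n < a → n < fold a
  fold-large {a} p = ℕ.≤-trans
    (subst (_≤ a ∸ n) (ℕ.m+n∸n≡m (suc n) n) (ℕ.∸-monoˡ-≤ n p)) (ℕ.m≤m+n _ _)

  module _ {H : ℕ × ℕ → ℤ} (H-folded : Folded n H) where
    open Folded H-folded

    vanish′ : ∀ {y} → n < y → ∀ x → H (x , y) ≡ + 0
    vanish′ {y} n<y x = trans (symmetric x y) (vanish n<y x)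

    unfold-dirichlet : Dirichlet (n ℕ.+ n) (H ∘ fold²)
    unfold-dirichlet = record
      { left   = λ b → vanish (ℕ.≤-reflexive (sym fold-zero)) (fold b)
      ; bottom = λ a → vanish′ (ℕ.≤-reflexive (sym fold-zero)) (fold a)
      ; right  = λ p b → vanish (fold-large p) (fold b)
      ; top    = λ p a → vanish′ (fold-large p) (fold a)
      }

    -- Folding acts on each coordinate separately, so `fold-neighbours` treats each pair of opposite
    -- neighbours; `mirror` and its transpose supply the condition at distance 0.
    laplacian-unfold : ∀ a b → a < n ℕ.+ n → b < n ℕ.+ n →
      ∃ λ x → ∃ λ y → x < n × y < n × laplacian (H ∘ fold²) a b ≡ laplacian H x y
    laplacian-unfold a b p q with fold-neighbours a p | fold-neighbours b q
    ... | x , x<n , ex , hx | y , y<n , ey , hy = x , y , x<n , y<n ,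
      cong₂ (λ s t → + 4 ℤ.* s ℤ.- t) (cong₂ (λ s t → H (s , t)) ex ey)
        (cong₂ ℤ._+_
          (trans (cong (λ t → H (fold a , t) ℤ.+ H (fold (suc (suc a)) , t)) ey)
                 (hx (λ t → H (t , suc y))
                     (trans (symmetric 0 (suc y)) (trans (mirror y) (symmetric (suc y) 1)))))
          (trans (cong (λ t → H (t , fold b) ℤ.+ H (t , fold (suc (suc b)))) ex)
                 (hy (λ t → H (suc x , t)) (mirror x))))

  -- The coordinates from `n + 1` to `2n` become the distances from 1 to `n`; distance 0 is
  -- coordinate `n`, just across the axis.
  quadrant : (ℕ × ℕ → ℤ) → ℕ × ℕ → ℤ
  quadrant F (x , y) = F (x ℕ.+ n , y ℕ.+ n)

  quadrant-folded : ∀ {F K} → Dirichlet (n ℕ.+ n) F →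
    (∀ {a b} → a < n ℕ.+ n → b < n ℕ.+ n → laplacian F a b ≡ K) → Folded n (quadrant F)
  quadrant-folded {F} F-dir e = record
    { symmetric = λ x y → swap (x ℕ.+ n) (y ℕ.+ n)
    -- Reflection is available in the first coordinate only: transpose, reflect `n` to `suc n`,
    -- transpose back.
    ; mirror    = λ x → trans (swap (suc x ℕ.+ n) n) (trans
        (constant-reflect F-dir e n (suc x ℕ.+ n)) (trans
        (cong (λ t → F (t , suc x ℕ.+ n)) (ℕ.m+n∸n≡m (suc n) n))
        (swap (suc n) (suc x ℕ.+ n))))
    ; vanish    = λ n<x y → Dirichlet.right F-dir (ℕ.+-monoˡ-< n n<x) (y ℕ.+ n)
    }
    where
    swap : ∀ a b → F (a , b) ≡ F (b , a)
    swap = constant-symmetric F-dir e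

-- The triangle operator on folded functions.

module TriangleLaplacian (n : ℕ) where
  open Triangle n hiding (complete; unique; wt)
  open SandpileGraph (P n) using (Δ̃; deg; complete; unique)

  position : V → ℕ × ℕ
  position (i , j) = suc (toℕ i) , suc (toℕ j)

  position-injective : ∀ {v w} → position v ≡ position w → v ≡ w
  position-injective {i , j} {i′ , j′} e
    with Fin.toℕ-injective {i = i} {i′} (ℕ.suc-injective (cong proj₁ e))
  ... | refl = cong (i ,_) (Fin.toℕ-injective (ℕ.suc-injective (cong proj₂ e)))

  open ZeroExtension triVertices complete unique position position-injective public

  ext-below : ∀ f a → ext f (a , 0) ≡ + 0
  ext-below f a = ext-outside f (a , 0) λ _ ()

  ext-above : ∀ f {a b} → a < b → ext f (a , b) ≡ + 0
  ext-above f {a} {b} a<b = ext-outside f (a , b)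
    λ { (i , j) refl → ℕ.<⇒≱ a<b (Fin.toℕ<n j) }

  ext-right : ∀ f {a} b → n < a → ext f (a , b) ≡ + 0
  ext-right f {a} b n<a = ext-outside f (a , b) λ { (i , j) refl → ℕ.<⇒≱ n<a (Fin.toℕ<n i) }

  vertexAt : ∀ {a b} → b ≤ a → a < n → ∃ λ v → position v ≡ (suc a , suc b)
  vertexAt {a} {b} b≤a a<n = (i , fromℕ< b<) ,
    cong₂ (λ s t → suc s , suc t) (Fin.toℕ-fromℕ< a<n) (Fin.toℕ-fromℕ< b<)
    where
    i : Fin n
    i = fromℕ< a<n
    b< : b < suc (toℕ i)
    b< = s≤s (subst (b ≤_) (sym (Fin.toℕ-fromℕ< a<n)) b≤a)

  ext-restrict : ∀ F {a b} → b ≤ a → a < n → ext (F ∘ position) (suc a , suc b) ≡ F (suc a , suc b)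
  ext-restrict F b≤a a<n with vertexAt b≤a a<n
  ... | v , e = subst (λ y → ext (F ∘ position) y ≡ F y) e (ext-inside (F ∘ position) v)

  -- What the direction towards `y` contributes to `Δ̃ f` at a vertex of value `m`: a difference if
  -- `y` is a vertex, and 0 otherwise, both extensions being 0 there.
  edge : (V → ℤ) → ℤ → ℕ × ℕ → ℤ
  edge f m y = ext (λ _ → + 1) y ℤ.* m ℤ.- ext f y

  -- The sink term is grouped with the right neighbour because the sink edges occur exactly where
  -- that neighbour is missing.
  Δ̃-edges : ∀ f i j → let v = i , j ; x = toℕ i ; y = toℕ j ; e = edge f (f v) in
    Δ̃ f v ≡ (e (x , suc y) ℤ.+ (e (suc (suc x) , suc y) ℤ.+ + wtSink v ℤ.* f v)) ℤ.+
            (e (suc x , y) ℤ.+ e (suc x , suc (suc y)))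
  Δ̃-edges f i j = trans
    (cong₂ (λ s t → (s ℤ.+ + wtSink v) ℤ.* f v ℤ.- t) (sum-adj x y) (∑-adj f x y))
    (regroup (f v) (+ wtSink v)
      (one (x , suc y)) (one (suc (suc x) , suc y))
      (one (suc x , y)) (one (suc x , suc (suc y)))
      (ext f (x , suc y)) (ext f (suc (suc x) , suc y))
      (ext f (suc x , y)) (ext f (suc x , suc (suc y))))
    where
    v : V
    v = i , j
    x y : ℕ
    x = toℕ i
    y = toℕ j
    one : ℕ × ℕ → ℤ
    one = ext (λ _ → + 1)
    regroup : ∀ m s l r d u l′ r′ d′ u′ →
      (((l ℤ.+ r) ℤ.+ (d ℤ.+ u)) ℤ.+ s) ℤ.* m ℤ.- ((l′ ℤ.+ r′) ℤ.+ (d′ ℤ.+ u′)) ≡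
      ((l ℤ.* m ℤ.- l′) ℤ.+ ((r ℤ.* m ℤ.- r′) ℤ.+ s ℤ.* m)) ℤ.+
      ((d ℤ.* m ℤ.- d′) ℤ.+ (u ℤ.* m ℤ.- u′))
    regroup = solve-∀

  wtSink≡1 : ∀ i j → suc (toℕ i) ≡ n → wtSink (i , j) ≡ 1
  wtSink≡1 i j e with suc (toℕ i) ≡ᵇ n | ℕ.≡⇒≡ᵇ (suc (toℕ i)) n e
  ... | true | _ = refl

  wtSink≡0 : ∀ i j → suc (toℕ i) < n → wtSink (i , j) ≡ 0
  wtSink≡0 i j i<n with suc (toℕ i) ≡ᵇ n | ℕ.≡ᵇ⇒≡ (suc (toℕ i)) n
  ... | true  | e = contradiction (e _) (ℕ.<⇒≢ i<n)
  ... | false | _ = refl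

  edge-outside : ∀ f m {y} → (∀ g → ext g y ≡ + 0) → edge f m y ≡ + 0
  edge-outside f m e = cong₂ (λ s t → s ℤ.* m ℤ.- t) (e λ _ → + 1) (e f)

  module _ {H : ℕ × ℕ → ℤ} (H-folded : Folded n H) where
    open Folded H-folded

    f : V → ℤ
    f = H ∘ position

    edge-inside : ∀ m {a b} → b ≤ a → a < n →
                  edge f m (suc a , suc b) ≡ m ℤ.- H (suc a , suc b)
    edge-inside m b≤a a<n = cong₂ ℤ._-_
      (trans (cong (ℤ._* m) (ext-restrict (λ _ → + 1) b≤a a<n)) (ℤ.*-identityˡ m))
      (ext-restrict H b≤a a<n)

    -- In the lowest row the missing edge contributes 0, and so does the difference to the mirror
    -- image.
    edge-down : ∀ {x y} → y ≤ x → x < n →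
      edge f (H (suc x , suc y)) (suc x , y) ≡ H (suc x , suc y) ℤ.- H (suc x , y)
    edge-down {x} {zero}  _   _   = trans
      (edge-outside f (H (suc x , 1)) {suc x , 0} λ g → ext-below g (suc x))
      (sym (ℤ.i≡j⇒i-j≡0 (sym (mirror x))))
    edge-down {x} {suc y} y<x x<n = edge-inside (H (suc x , suc (suc y))) (ℕ.<⇒≤ y<x) x<n

    edge-left : ∀ m {x y} → y < x → x < n →
                edge f m (x , suc y) ≡ m ℤ.- H (x , suc y)
    edge-left m {suc x} (s≤s y≤x) x<n = edge-inside m y≤x (ℕ.<⇒≤ x<n)

    -- For `suc (toℕ i) ≡ n` the sink edge contributes `m`, the difference to the value 0 of `H`
    -- outside the grid.
    edge-right : ∀ i j → let x = suc (toℕ i) ; y = suc (toℕ j) ; m = H (x , y) in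
      edge f m (suc x , y) ℤ.+ + wtSink (i , j) ℤ.* m ≡ m ℤ.- H (suc x , y)
    edge-right i j with ℕ.m≤n⇒m<n∨m≡n (Fin.toℕ<n i)
    ... | inj₁ x<n = trans
      (cong₂ (λ s t → s ℤ.+ + t ℤ.* m)
        (edge-inside m (ℕ.≤-trans (ℕ.≤-pred (Fin.toℕ<n j)) (ℕ.n≤1+n _)) x<n)
        (wtSink≡0 i j x<n))
      (ℤ.+-identityʳ _)
      where
      m = H (position (i , j))
    ... | inj₂ x≡n = trans
      (cong₂ (λ s t → s ℤ.+ + t ℤ.* m)
        (edge-outside f m {suc (suc (toℕ i)) , y} λ g → ext-right g y n<)
        (wtSink≡1 i j x≡n))
      (trans (ℤ.+-identityˡ _) (trans (ℤ.*-identityˡ m) (sym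
        (trans (cong (λ t → m ℤ.- t) (vanish n< y)) (ℤ.+-identityʳ m)))))
      where
      m = H (position (i , j))
      y = suc (toℕ j)
      n< : n < suc (suc (toℕ i))
      n< = s≤s (ℕ.≤-reflexive (sym x≡n))

    Δ̃-off-diagonal : ∀ i j → toℕ j < toℕ i → Δ̃ f (i , j) ≡ laplacian H (toℕ i) (toℕ j)
    Δ̃-off-diagonal i j j<i = trans (Δ̃-edges f i j) (trans
      (cong₂ ℤ._+_ (cong₂ ℤ._+_ (edge-left m j<i (Fin.toℕ<n i)) (edge-right i j))
                   (cong₂ ℤ._+_ (edge-down (ℕ.<⇒≤ j<i) (Fin.toℕ<n i))
                                (edge-inside m j<i (Fin.toℕ<n i))))
      (collect (H (position (i , j))) (H (x , suc y)) (H (suc (suc x) , suc y))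
               (H (suc x , y)) (H (suc x , suc (suc y)))))
      where
      x = toℕ i
      y = toℕ j
      m = H (position (i , j))
      collect : ∀ m l r d u →
        ((m ℤ.- l) ℤ.+ (m ℤ.- r)) ℤ.+ ((m ℤ.- d) ℤ.+ (m ℤ.- u)) ≡
        + 4 ℤ.* m ℤ.- ((l ℤ.+ r) ℤ.+ (d ℤ.+ u))
      collect = solve-∀

    -- The left and upper neighbours are missing from the triangle, but by symmetry `H` takes the
    -- lower and right values there, so the full Laplacian counts each remaining difference twice.
    Δ̃-diagonal : ∀ i j → toℕ j ≡ toℕ i →
                 + 2 ℤ.* Δ̃ f (i , j) ≡ laplacian H (toℕ i) (toℕ i)
    Δ̃-diagonal i j j≡i = trans
      (cong (λ t → + 2 ℤ.* t) (trans (Δ̃-edges f i j) (cong₂ ℤ._+_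
        (cong₂ ℤ._+_ (edge-outside f m {x , suc (toℕ j)} λ g →
                       ext-above g (s≤s (ℕ.≤-reflexive (sym j≡i))))
                     (edge-right i j))
        (cong₂ ℤ._+_ (edge-down (ℕ.≤-reflexive j≡i) (Fin.toℕ<n i))
          (edge-outside f m {suc x , suc (suc (toℕ j))} λ g →
            ext-above g (s≤s (s≤s (ℕ.≤-reflexive (sym j≡i)))))))))
      (diagonal j≡i)
      where
      x = toℕ i
      m = H (position (i , j))
      collect : ∀ m r d →
        + 2 ℤ.* ((+ 0 ℤ.+ (m ℤ.- r)) ℤ.+ ((m ℤ.- d) ℤ.+ + 0)) ≡
        + 4 ℤ.* m ℤ.- ((d ℤ.+ r) ℤ.+ (d ℤ.+ r))
      collect = solve-∀
      diagonal : ∀ {y} → y ≡ x →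
        + 2 ℤ.* ((+ 0 ℤ.+ (H (suc x , suc y) ℤ.- H (suc (suc x) , suc y))) ℤ.+
                 ((H (suc x , suc y) ℤ.- H (suc x , y)) ℤ.+ + 0)) ≡ laplacian H x x
      diagonal refl = trans
        (collect (H (suc x , suc x)) (H (suc (suc x) , suc x)) (H (suc x , x)))
        (cong₂ (λ l u → + 4 ℤ.* H (suc x , suc x) ℤ.-
                        ((l ℤ.+ H (suc (suc x) , suc x)) ℤ.+ (H (suc x , x) ℤ.+ u)))
          (symmetric (suc x) x) (symmetric (suc (suc x)) (suc x)))

  -- Sorting the coordinates reflects points above the diagonal into the triangle; clamping 0 to 1
  -- builds in `mirror`.
  symmetrize : (V → ℤ) → ℕ × ℕ → ℤ
  symmetrize g (x , y) = ext g ((1 ⊔ x) ⊔ (1 ⊔ y) , (1 ⊔ x) ⊓ (1 ⊔ y))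

  symmetrize-folded : ∀ g → Folded n (symmetrize g)
  symmetrize-folded g = record
    { symmetric = λ x y → cong₂ (λ s t → ext g (s , t))
        (ℕ.⊔-comm (1 ⊔ x) (1 ⊔ y)) (ℕ.⊓-comm (1 ⊔ x) (1 ⊔ y))
    ; mirror    = λ x → refl
    ; vanish    = λ {x} n<x y → ext-right g ((1 ⊔ x) ⊓ (1 ⊔ y))
        (ℕ.≤-trans n<x (ℕ.≤-trans (ℕ.m≤n⊔m 1 x) (ℕ.m≤m⊔n (1 ⊔ x) (1 ⊔ y))))
    }

  symmetrize-position : ∀ g v → symmetrize g (position v) ≡ g v
  symmetrize-position g (i , j) = trans
    (cong₂ (λ s t → ext g (suc s , suc t)) (ℕ.m≥n⇒m⊔n≡m j≤i) (ℕ.m≥n⇒m⊓n≡n j≤i))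
    (ext-inside g (i , j))
    where
    j≤i : toℕ j ≤ toℕ i
    j≤i = ℕ.≤-pred (Fin.toℕ<n j)

  -- In the paper's indices this is v_{i,j} ↦ k (n + 1 - i): a linear function, hence
  -- harmonic off the diagonal, and Δ̃ maps it to k times the sum of the diagonal vertices.
  height : ℤ → ℕ × ℕ → ℤ
  height k (x , y) = k ℤ.* + (suc n ∸ (x ⊔ y))

  height-folded : ∀ k → Folded n (height k)
  height-folded k = record
    { symmetric = λ x y → cong (λ t → k ℤ.* + (suc n ∸ t)) (ℕ.⊔-comm x y)
    ; mirror    = λ x → cong (λ t → k ℤ.* + (n ∸ t)) (sym (ℕ.⊔-identityʳ x))
    ; vanish    = λ {x} n<x y → trans
        (cong (λ t → k ℤ.* + t) (ℕ.m≤n⇒m∸n≡0 (ℕ.≤-trans n<x (ℕ.m≤m⊔n x y))))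
        (ℤ.*-zeroʳ k)
    }

  module _ (k : ℤ) {x : ℕ} (x<n : x < n) where
    private
      -- With this `t`, the coordinates `x`, `suc x` and `suc (suc x)` have heights `t + 2`, `t + 1`
      -- and `t`.
      t : ℕ
      t = n ∸ suc x
      level : ℕ → ℤ
      level t = k ℤ.* + t

      height-at : ∀ a b {c s} → a ⊔ b ≡ c → suc n ∸ c ≡ s → height k (a , b) ≡ level s
      height-at a b p q = cong (λ s → k ℤ.* + s) (trans (cong (suc n ∸_) p) q)

      t₀ : suc n ∸ x ≡ suc (suc t)
      t₀ = trans (ℕ.+-∸-assoc 1 (ℕ.<⇒≤ x<n)) (cong suc (ℕ.+-∸-assoc 1 x<n))
      t₁ : suc n ∸ suc x ≡ suc t
      t₁ = ℕ.+-∸-assoc 1 x<n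

    laplacian-height-off : ∀ {y} → y < x → laplacian (height k) x y ≡ + 0
    laplacian-height-off {y} y<x = trans
      (cong₂ (λ s r → + 4 ℤ.* s ℤ.- r)
        (height-at (suc x) (suc y) (ℕ.m≥n⇒m⊔n≡m (s≤s (ℕ.<⇒≤ y<x))) t₁)
        (cong₂ ℤ._+_
          (cong₂ ℤ._+_ (height-at x (suc y) (ℕ.m≥n⇒m⊔n≡m y<x) t₀)
                       (height-at (suc (suc x)) (suc y)
                         (ℕ.m≥n⇒m⊔n≡m (s≤s (ℕ.m≤n⇒m≤1+n (ℕ.<⇒≤ y<x)))) refl))
          (cong₂ ℤ._+_ (height-at (suc x) y
                         (ℕ.m≥n⇒m⊔n≡m (ℕ.m≤n⇒m≤1+n (ℕ.<⇒≤ y<x))) t₁)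
                       (height-at (suc x) (suc (suc y)) (ℕ.m≥n⇒m⊔n≡m (s≤s y<x)) t₁))))
      (cancel k (+ t))
      where
      cancel : ∀ k t → + 4 ℤ.* (k ℤ.* (+ 1 ℤ.+ t)) ℤ.-
        ((k ℤ.* (+ 2 ℤ.+ t) ℤ.+ k ℤ.* t) ℤ.+
         (k ℤ.* (+ 1 ℤ.+ t) ℤ.+ k ℤ.* (+ 1 ℤ.+ t))) ≡ + 0
      cancel = solve-∀

    -- Two neighbours share the level `t + 1` of the centre and two lie one level lower, leaving a
    -- surplus of twice `k`.
    laplacian-height-diagonal : laplacian (height k) x x ≡ + 2 ℤ.* k
    laplacian-height-diagonal = trans
      (cong₂ (λ s r → + 4 ℤ.* s ℤ.- r)
        (height-at (suc x) (suc x) (ℕ.⊔-idem (suc x)) t₁)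
        (cong₂ ℤ._+_
          (cong₂ ℤ._+_ (height-at x (suc x) (ℕ.m≤n⇒m⊔n≡n (ℕ.n≤1+n x)) t₁)
                       (height-at (suc (suc x)) (suc x) (ℕ.m≥n⇒m⊔n≡m (ℕ.n≤1+n (suc x))) refl))
          (cong₂ ℤ._+_ (height-at (suc x) x (ℕ.m≥n⇒m⊔n≡m (ℕ.n≤1+n x)) t₁)
                       (height-at (suc x) (suc (suc x)) (ℕ.m≤n⇒m⊔n≡n (ℕ.n≤1+n (suc x))) refl))))
      (cancel k (+ t))
      where
      cancel : ∀ k t → + 4 ℤ.* (k ℤ.* (+ 1 ℤ.+ t)) ℤ.-
        ((k ℤ.* (+ 1 ℤ.+ t) ℤ.+ k ℤ.* t) ℤ.+ (k ℤ.* (+ 1 ℤ.+ t) ℤ.+ k ℤ.* t)) ≡ + 2 ℤ.* k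
      cancel = solve-∀

  Δ̃-height-off : ∀ k i j → toℕ j < toℕ i → Δ̃ (height k ∘ position) (i , j) ≡ + 0
  Δ̃-height-off k i j j<i = trans (Δ̃-off-diagonal (height-folded k) i j j<i)
    (laplacian-height-off k (Fin.toℕ<n i) j<i)

  Δ̃-height-diagonal : ∀ k i j → toℕ j ≡ toℕ i → Δ̃ (height k ∘ position) (i , j) ≡ k
  Δ̃-height-diagonal k i j j≡i = ℤ.*-cancelˡ-≡ (+ 2) _ _
    (trans (Δ̃-diagonal (height-folded k) i j j≡i)
           (laplacian-height-diagonal k (Fin.toℕ<n i)))

-- Transfer of solutions between grid and triangle.

Δ̃-cong : ∀ G {f g : SandpileGraph.ℤṼ G} → (∀ v → f v ≡ g v) →
         ∀ v → SandpileGraph.Δ̃ G f v ≡ SandpileGraph.Δ̃ G g v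
Δ̃-cong G e v = cong₂ (λ s t → + deg v ℤ.* s ℤ.- t) (e v)
  (∑-cong vertices λ w → cong (λ t → t ℤ.* + wt (just w) (just v)) (e w))
  where open SandpileGraph G

-- The integers `k` that annihilate `2⃗ G` in the sandpile group.
InImage : SandpileGraph → ℤ → Set
InImage G k = ∃ λ f → ∀ v → SandpileGraph.Δ̃ G f v ≡ k ℤ.* + 2

module _ (n : ℕ) where
  private
    module Gr = GridLaplacian (n ℕ.+ n)
    module Tr = TriangleLaplacian n
  open SandpileGraph (P n) using (Δ̃)

  -- The quadrant of a grid solution, restricted to the triangle, has image `2k` below the diagonal
  -- but only `k` on it; adding `height k` supplies the missing `k`.
  grid⇒triangle : ∀ k → InImage (SΓ (n ℕ.+ n) (n ℕ.+ n)) k → InImage (P n) k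
  grid⇒triangle k (f , e) = (λ v → c v ℤ.+ h v) , λ v@(i , j) →
    trans (Δ̃-+ (P n) c h v) (total i j (ℕ.m≤n⇒m<n∨m≡n (ℕ.≤-pred (Fin.toℕ<n j))))
    where
    constant = Gr.laplacian-constant f e
    H : ℕ × ℕ → ℤ
    H = quadrant n (Gr.ext f)
    H-folded : Folded n H
    H-folded = quadrant-folded n (Gr.ext-dirichlet f) constant
    H-constant : ∀ {x y} → x < n → y < n → laplacian H x y ≡ k ℤ.* + 2
    H-constant x<n y<n = constant (ℕ.+-monoˡ-< n x<n) (ℕ.+-monoˡ-< n y<n)
    c h : Triangle.V n → ℤ
    c = H ∘ Tr.position
    h = Tr.height k ∘ Tr.position
    double : ∀ k → k ℤ.* + 2 ≡ + 2 ℤ.* k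
    double = solve-∀
    k+k : ∀ k → k ℤ.+ k ≡ k ℤ.* + 2
    k+k = solve-∀
    total : ∀ i j → toℕ j < toℕ i ⊎ toℕ j ≡ toℕ i →
            Δ̃ c (i , j) ℤ.+ Δ̃ h (i , j) ≡ k ℤ.* + 2
    total i j (inj₁ j<i) = trans (cong₂ ℤ._+_
      (trans (Tr.Δ̃-off-diagonal H-folded i j j<i)
             (H-constant (Fin.toℕ<n i) (ℕ.<-trans j<i (Fin.toℕ<n i))))
      (Tr.Δ̃-height-off k i j j<i)) (ℤ.+-identityʳ _)
    total i j (inj₂ j≡i) = trans (cong₂ ℤ._+_
      (ℤ.*-cancelˡ-≡ (+ 2) _ _ (trans (Tr.Δ̃-diagonal H-folded i j j≡i)
        (trans (H-constant (Fin.toℕ<n i) (Fin.toℕ<n i)) (double k))))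
      (Tr.Δ̃-height-diagonal k i j j≡i)) (k+k k)

  -- Adding `height (- k)` lowers the image on the diagonal from `2k` to `k`; `Δ̃-diagonal` doubles
  -- it back once the function is symmetrized and unfolded to the grid.
  triangle⇒grid : ∀ k → InImage (P n) k → InImage (SΓ (n ℕ.+ n) (n ℕ.+ n)) k
  triangle⇒grid k (g , e) = H ∘ fold² n ∘ Gr.position , λ v →
    trans (Gr.Δ̃-restrict (unfold-dirichlet n H-folded) v) (constant v)
    where
    h c : Triangle.V n → ℤ
    h = Tr.height (ℤ.- k) ∘ Tr.position
    c v = g v ℤ.+ h v
    H : ℕ × ℕ → ℤ
    H = Tr.symmetrize c
    H-folded : Folded n H
    H-folded = Tr.symmetrize-folded c
    Δ̃-H : ∀ v → Δ̃ (H ∘ Tr.position) v ≡ k ℤ.* + 2 ℤ.+ Δ̃ h v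
    Δ̃-H v = trans (Δ̃-cong (P n) (Tr.symmetrize-position c) v)
      (trans (Δ̃-+ (P n) g h v) (cong (ℤ._+ Δ̃ h v) (e v)))
    halve : ∀ k → + 2 ℤ.* (k ℤ.* + 2 ℤ.+ ℤ.- k) ≡ k ℤ.* + 2
    halve = solve-∀
    constant-at : ∀ i j → toℕ j < toℕ i ⊎ toℕ j ≡ toℕ i →
                  laplacian H (toℕ i) (toℕ j) ≡ k ℤ.* + 2
    constant-at i j (inj₁ j<i) = trans (sym (Tr.Δ̃-off-diagonal H-folded i j j<i))
      (trans (Δ̃-H (i , j)) (trans
        (cong (λ t → k ℤ.* + 2 ℤ.+ t) (Tr.Δ̃-height-off (ℤ.- k) i j j<i)) (ℤ.+-identityʳ _)))
    constant-at i j (inj₂ j≡i) = trans (cong (laplacian H (toℕ i)) j≡i)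
      (trans (sym (Tr.Δ̃-diagonal H-folded i j j≡i)) (trans
        (cong (λ t → + 2 ℤ.* t) (trans (Δ̃-H (i , j))
          (cong (λ t → k ℤ.* + 2 ℤ.+ t) (Tr.Δ̃-height-diagonal (ℤ.- k) i j j≡i))))
        (halve k)))
    constant-below : ∀ {x y} → x < n → y ≤ x → laplacian H x y ≡ k ℤ.* + 2
    constant-below {x} {y} x<n y≤x with Tr.vertexAt y≤x x<n
    ... | (i , j) , refl = constant-at i j (ℕ.m≤n⇒m<n∨m≡n y≤x)
    constant-quadrant : ∀ {x y} → x < n → y < n → laplacian H x y ≡ k ℤ.* + 2
    constant-quadrant {x} {y} x<n y<n with ℕ.≤-total y x
    ... | inj₁ y≤x = constant-below x<n y≤x
    ... | inj₂ x≤y = trans (laplacian-symmetric (Folded.symmetric H-folded) x y)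
                           (constant-below y<n x≤y)
    constant : ∀ v → laplacian (H ∘ fold² n) (toℕ (proj₁ v)) (toℕ (proj₂ v)) ≡ k ℤ.* + 2
    constant (a , b) with laplacian-unfold n H-folded (toℕ a) (toℕ b) (Fin.toℕ<n a) (Fin.toℕ<n b)
    ... | _ , _ , x<n , y<n , e = trans e (constant-quadrant x<n y<n)

-- From annihilators to the monomorphism of sandpile groups.

module _ (G : SandpileGraph) where
  open Cyclic (𝒮 G) using (_·_)
  open SandpileGraph G

  ∼⇒InImage : ∀ k l → k · 2⃗ G ∼ l · 2⃗ G → InImage G (k ℤ.- l)
  ∼⇒InImage k l (image f e) = f , λ v → trans (sym (e v)) (·-difference G k l (2⃗ G) v)

  InImage⇒∼ : ∀ k l → InImage G (k ℤ.- l) → k · 2⃗ G ∼ l · 2⃗ G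
  InImage⇒∼ k l (f , e) = image f λ v → trans (·-difference G k l (2⃗ G) v) (sym (e v))

-- Whether the multiples by `k` and `l` agree depends only on `k - l`, so equal annihilators give
-- both hypotheses of `cyclic-monomorphism`.
sandpile-cyclic-monomorphism : (Γ Λ : SandpileGraph) →
    (∀ k → InImage Γ k → InImage Λ k) → (∀ k → InImage Λ k → InImage Γ k) →
    let module C = AbelianGroup (⟨_⟩ (𝒮 Γ) (2⃗ Γ))
        module D = AbelianGroup (𝒮 Λ)
        open GroupMorphisms C.rawGroup D.rawGroup
        g        = generator (𝒮 Γ) (2⃗ Γ)
    in ∃ λ (ψ : C.Carrier → D.Carrier) →
         D._≈_ (ψ g) (2⃗ Λ) ×
         IsGroupMonomorphism ψ ×
         ((φ : C.Carrier → D.Carrier) → IsGroupHomomorphism φ →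
            D._≈_ (φ g) (2⃗ Λ) → (x : C.Carrier) → D._≈_ (φ x) (ψ x))
sandpile-cyclic-monomorphism Γ Λ to from =
  cyclic-monomorphism (𝒮 Γ) (𝒮 Λ) (2⃗ Γ) (2⃗ Λ)
    (λ k l e → InImage⇒∼ Λ k l (to (k ℤ.- l) (∼⇒InImage Γ k l e)))
    (λ k l e → InImage⇒∼ Γ k l (from (k ℤ.- l) (∼⇒InImage Λ k l e)))

theorem5p5 : (n : ℕ) → 1 ≤ n →
    let Γ        = SΓ (2 * n) (2 * n)
        module C = AbelianGroup (⟨_⟩ (𝒮 Γ) (2⃗ Γ))
        module D = AbelianGroup (𝒮 (P n))
        open GroupMorphisms C.rawGroup D.rawGroup
        g        = generator (𝒮 Γ) (2⃗ Γ)
    in ∃ λ (ψ : C.Carrier → D.Carrier) →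
         D._≈_ (ψ g) (2⃗ (P n)) ×
         IsGroupMonomorphism ψ ×
         ((φ : C.Carrier → D.Carrier) → IsGroupHomomorphism φ →
            D._≈_ (φ g) (2⃗ (P n)) → (x : C.Carrier) → D._≈_ (φ x) (ψ x))
theorem5p5 n _ = sandpile-cyclic-monomorphism (SΓ (2 * n) (2 * n)) (P n)
  (λ k h → grid⇒triangle n k (subst (λ N → InImage (SΓ N N) k) 2n≡n+n h))
  (λ k h → subst (λ N → InImage (SΓ N N) k) (sym 2n≡n+n) (triangle⇒grid n k h))
  where
  2n≡n+n : 2 * n ≡ n ℕ.+ n
  2n≡n+n = cong (n ℕ.+_) (ℕ.+-identityʳ n)
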